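{- Let $r\ge2$ and let $\mathbf C$ be a full subcategory of $\mathbf{OHgr}_{srq}(r)$ such that for every finite chain $\mathcal L$ there is an object in $\mathrm{Ob}(\mathbf C)$ isomorphic to $r\boxtimes\mathcal L$. Then $\mathbf C$ has the dual Ramsey property. In particular, the following categories have the dual Ramsey property: (1) the category $\mathbf{OHgr}_{srq}(r)$ for every $r\ge2$; (2) the category $\mathbf{OGra}_{srq}$; (3) the full subcategory of $\mathbf{OGra}_{srq}$ spanned by bipartite graphs; (4) for each fixed $n\ge3$, the full subcategory of $\mathbf{OGra}_{srq}$ spanned by $K_n$-free graphs.
   Context: Let $r\ge2$; $\binom Vk$ is the set of $k$-element subsets of $V$. A linearly ordered reflexive $r$-uniform hypergraph is $(V,E,\sqsubset)$ with $E=\binom V1\cup S$ for some $S\subseteq\binom Vr$ and $\sqsubset$ a (strict) linear order on $V$. A hypergraph homomorphism $f:(V,E)\to(V',E')$ is a map $f:V\to V'$ such that $e\in E$ implies $\{f(x):x\in e\}\in E'$; it induces $\tilde f:E\to E'$, $\tilde f(e)=\{f(x):x\in e\}$. Rigid surjection: a surjection $f$ between finite chains $(X,<)\to(Y,<')$ such that $\min f^{ -1}(x)<\min f^{ -1}(y)$ whenever $x<'y$. For a finite chain $(A,\sqsubset)$ and distinct $X,Y\subseteq A$ put $X\sqsubset_{alex}Y$ iff $X\subsetneq Y$, or $X,Y$ are incomparable under inclusion and $\max(X\setminus Y)\sqsubset\max(Y\setminus X)$. The linear order $\sqsubset_{sal}$ on $\mathcal P(A)$: $\varnothing$ is least; $\{x\}\sqsubset_{sal}\{y\}$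 iff $x\sqsubset y$; if $|X|=1$ and $|Y|>1$ then $X\sqsubset_{sal}Y$; if $|X|,|Y|>1$ then $X\sqsubset_{sal}Y$ iff $X\sqsubset_{alex}Y$. A strong rigid quotient map of hypergraphs from $(V,E,\sqsubset)$ to $(V',E',\sqsubset')$ is a hypergraph homomorphism $f:(V,E)\to(V',E')$ such that $\tilde f:(E,\sqsubset_{sal})\to(E',\sqsubset'_{sal})$ is a rigid surjection, and for every $e=\{x_1,\ldots,x_r\}\in E$, if $f|_e$ is not constant then $x_i\sqsubset x_j\Rightarrow f(x_i)\sqsubset'f(x_j)$ for all $i,j$. $\mathbf{OHgr}_{srq}(r)$ is the category of finite linearly ordered reflexive $r$-uniform hypergraphs and strong rigid quotient maps of hypergraphs; $\mathbf{OGra}_{srq}=\mathbf{OHgr}_{srq}(2)$, the category of finite linearly ordered reflexive graphs. Bipartiteness and $K_n$-freeness refer to the non-loop (2-element) edges. For a finite chain $\mathcal L=\{\ell_1\sqsubset\cdots\sqsubset\ell_N\}$, $r\boxtimes\mathcal L$ is the linearly ordered reflexive $r$-uniform hypergraph with vertex set $\{1,\ldots,r\}\times\{\ell_1,\ldots,\ell_N\}$, edge set consisting of all singletons and the sets $\{(1,\ell_j),(2,\ell_j),\ldots,(r,\ell_j)\}$, $1\le j\le N$, and linear order $(i,\ell)\prec(j,k)$ iff $\ell\sqsubset k$, or $\ell=k$ and $i<j$. A category $\mathbf C$ has the dual Ramsey property if for every integer $k\ge2$ and all objects $\mathcal A,\mathcal B$ with $\hom_{\mathbf C}(\mathcal B,\mathcal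 A)\neq\varnothing$ there is an object $\mathcal C$ such that for every coloring $\chi:\hom_{\mathbf C}(\mathcal C,\mathcal A)\to\{1,\ldots,k\}$ there is $w\in\hom_{\mathbf C}(\mathcal C,\mathcal B)$ such that $\chi$ is constant on $\{f\cdot w: f\in\hom_{\mathbf C}(\mathcal B,\mathcal A)\}$. -}

module Defs where

open import Level using (Level; 0ℓ; _⊔_) renaming (suc to lsuc)
open import Data.Bool.Base using (true)
import Data.Bool.Properties as Bool
open import Data.Empty using (⊥-elim)
open import Data.Fin.Base as Fin using (Fin; zero; suc; combine; remQuot)
import Data.Fin.Properties as Fin
open import Data.Fin.Subset as Subset
  using (Subset; inside; outside; _∈_; _∉_; _⊆_; _⊈_; _⊂_; _─_; _∪_; ⁅_⁆; ∣_∣)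
open import Data.Fin.Subset.Properties
open import Data.Nat.Base as ℕ using (ℕ; zero; suc; z≤n; s≤s)
import Data.Nat.Properties as ℕ
open import Data.Product.Base using (Σ; ∃₂; ∃-syntax; _×_; _,_; proj₁; proj₂)
open import Data.Product.Relation.Binary.Lex.Strict using (×-isStrictTotalOrder)
open import Data.Sum.Base using (_⊎_; inj₁; inj₂)
open import Data.Vec.Base using (tabulate; []; _∷_; here; there)
open import Data.Vec.Properties using (lookup∘tabulate; lookup⇒[]=; []=⇒lookup; ≡-dec)
open import Function.Base using (_∘_; _∘′_; id)
open import Function.Bundles using (Func; module Func)
import Function.Construct.Composition as Comp
import Function.Construct.Identity as Id
open import Function.Structures using (IsSurjection)
open import Relation.Binary.Bundles using (Setoid; StrictTotalOrder)
open import Relation.Binary.Core using (Rel)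
import Relation.Binary.Construct.On as On
open import Relation.Binary.Definitions using (tri<; tri≈; tri>; Trichotomous)
open import Relation.Binary.PropositionalEquality as ≡
  using (_≡_; _≢_; refl; sym; trans; cong; cong₂; subst; subst₂)
open import Relation.Binary.Structures
  using (IsStrictTotalOrder; IsEquivalence)
open import Relation.Binary.Structures.Biased using (isStrictTotalOrderᶜ)
open import Relation.Nullary using (¬_; Dec; yes; no; does; contradiction)
open import Relation.Nullary.Decidable using (_×-dec_; dec-true)
open import Relation.Unary using (Pred; Decidable)

private
  variable
    n m k : ℕ
    c ℓ₁ ℓ₂ c′ ℓ₁′ ℓ₂′ c″ ℓ₁″ ℓ₂″ : Level

------------------------------------------------------------------------
-- Categories and the dual Ramsey property

record Category (o h e : Level) : Set (lsuc (o ⊔ h ⊔ e)) where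
  infix  4 _≈_
  infixr 9 _·_
  field
    Obj       : Set o
    Hom       : Obj → Obj → Set h
    _≈_       : ∀ {A B} → Rel (Hom A B) e
    identity  : ∀ {A} → Hom A A
    _·_       : ∀ {A B C} → Hom B C → Hom A B → Hom A C
    equiv     : ∀ {A B} → IsEquivalence (_≈_ {A} {B})
    assoc     : ∀ {A B C D} {f : Hom C D} {g : Hom B C} {h : Hom A B} →
                (f · g) · h ≈ f · (g · h)
    identityˡ : ∀ {A B} {f : Hom A B} → identity · f ≈ f
    identityʳ : ∀ {A B} {f : Hom A B} → f · identity ≈ f
    ·-resp-≈  : ∀ {A B C} {f f′ : Hom B C} {g g′ : Hom A B} →
                f ≈ f′ → g ≈ g′ → f · g ≈ f′ · g′

  homSetoid : Obj → Obj → Setoid h e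
  homSetoid A B = record { Carrier = Hom A B ; _≈_ = _≈_ ; isEquivalence = equiv }

  infix 4 _≅_
  record _≅_ (A B : Obj) : Set (h ⊔ e) where
    field
      to   : Hom A B
      from : Hom B A
      isoˡ : from · to ≈ identity
      isoʳ : to · from ≈ identity

FullSubcategory : ∀ {o h e p} (C : Category o h e) →
                  Pred (Category.Obj C) p → Category (o ⊔ p) h e
FullSubcategory C P = record
  { Obj       = Σ Obj P
  ; Hom       = λ A B → Hom (proj₁ A) (proj₁ B)
  ; _≈_       = _≈_
  ; identity  = identity
  ; _·_       = _·_
  ; equiv     = equiv
  ; assoc     = assoc
  ; identityˡ = identityˡ
  ; identityʳ = identityʳ
  ; ·-resp-≈  = ·-resp-≈
  } where open Category C

-- Morphisms carry proofs, so a coloring of a hom-set is a map that respects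
-- equality of morphisms.
DualRamsey : ∀ {o h e} → Category o h e → Set (o ⊔ h ⊔ e)
DualRamsey 𝒞 =
  ∀ (k : ℕ) → 2 ℕ.≤ k → (A B : Obj) → Hom B A →
  ∃[ C ] ((χ : Func (homSetoid C A) (≡.setoid (Fin k))) →
          ∃[ w ] (∀ (f g : Hom B A) →
                  Func.to χ (f · w) ≡ Func.to χ (g · w)))
  where open Category 𝒞

------------------------------------------------------------------------
-- Chains and rigid surjections

record FiniteChain : Set₁ where
  infix 4 _⊏_
  field
    size               : ℕ
    _⊏_                : Rel (Fin size) 0ℓ
    isStrictTotalOrder : IsStrictTotalOrder _≡_ _⊏_

module _ (X : StrictTotalOrder c ℓ₁ ℓ₂) (Y : StrictTotalOrder c′ ℓ₁′ ℓ₂′) where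
  private
    module X = StrictTotalOrder X
    module Y = StrictTotalOrder Y

  -- x = min f⁻¹(y)
  IsMinPreimage : (X.Carrier → Y.Carrier) → Y.Carrier → X.Carrier → Set _
  IsMinPreimage f y x = f x Y.≈ y × (∀ x′ → f x′ Y.≈ y → x X.< x′ ⊎ x X.≈ x′)

  record IsRigidSurjection (f : X.Carrier → Y.Carrier) :
         Set (c ⊔ ℓ₁ ⊔ ℓ₂ ⊔ c′ ⊔ ℓ₁′ ⊔ ℓ₂′) where
    field
      isSurjection : IsSurjection X._≈_ Y._≈_ f
      rigid        : ∀ {y y′} → y Y.< y′ →
                     ∃₂ λ x x′ → IsMinPreimage f y x × IsMinPreimage f y′ x′ × x X.< x′

    open IsSurjection isSurjection public using () renaming (cong to f-cong)

id-isRigidSurjection : (X : StrictTotalOrder c ℓ₁ ℓ₂) → IsRigidSurjection X X id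
id-isRigidSurjection X = record
  { isSurjection = Id.isSurjection isEquivalence
  ; rigid        = λ {y} {y′} y<y′ → y , y′ , isMin y , isMin y′ , y<y′
  }
  where
  open StrictTotalOrder X
  isMin : ∀ y → IsMinPreimage X X id y y
  isMin y = Eq.refl , λ x′ x′≈y → inj₂ (Eq.sym x′≈y)

module _ (X : StrictTotalOrder c ℓ₁ ℓ₂) (Y : StrictTotalOrder c′ ℓ₁′ ℓ₂′)
         (Z : StrictTotalOrder c″ ℓ₁″ ℓ₂″) where
  private
    module X = StrictTotalOrder X
    module Y = StrictTotalOrder Y
    module Z = StrictTotalOrder Z

  ∘-isRigidSurjection : ∀ {f g} → IsRigidSurjection X Y f → IsRigidSurjection Y Z g →
                        IsRigidSurjection X Z (g ∘′ f)
  ∘-isRigidSurjection {f} {g} F G = record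
    { isSurjection = Comp.isSurjection F.isSurjection G.isSurjection
    ; rigid        = λ z<z′ →
        let a , a′ , a-min , a′-min , a<a′ = G.rigid z<z′
            p , p′ , p-min , p′-min , p<p′ = F.rigid a<a′
        in p , p′ , lift a-min p-min , lift a′-min p′-min , p<p′
    }
    where
    module F = IsRigidSurjection F
    module G = IsRigidSurjection G

    min-unique : ∀ {y x x′} → IsMinPreimage X Y f y x → IsMinPreimage X Y f y x′ → x X.≈ x′
    min-unique {y} {x} {x′} (fx , lx) (fx′ , lx′) with lx x′ fx′ | lx′ x fx
    ... | inj₂ x≈x′ | _         = x≈x′
    ... | inj₁ _    | inj₂ x′≈x = X.Eq.sym x′≈x
    ... | inj₁ x<x′ | inj₁ x′<x = ⊥-elim (X.asym x<x′ x′<x)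

    lift : ∀ {z a p} → IsMinPreimage Y Z g z a → IsMinPreimage X Y f a p →
           IsMinPreimage X Z (g ∘′ f) z p
    lift {z} {a} {p} (ga , la) p-min@(fp , lp) = Z.Eq.trans (G.f-cong fp) ga , least
      where
      least : ∀ x → g (f x) Z.≈ z → p X.< x ⊎ p X.≈ x
      least x gfx with la (f x) gfx
      ... | inj₂ a≈fx = lp x (Y.Eq.sym a≈fx)
      ... | inj₁ a<fx with F.rigid a<fx
      ...   | q , q′ , q-min , (_ , lq′) , q<q′ with lq′ x Y.Eq.refl
      ...     | inj₁ q′<x = inj₁ (X.<-respˡ-≈ (min-unique q-min p-min) (X.trans q<q′ q′<x))
      ...     | inj₂ q′≈x = inj₁ (X.<-respˡ-≈ (min-unique q-min p-min) (X.<-respʳ-≈ q′≈x q<q′))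

------------------------------------------------------------------------
-- The order ⊏sal on the subsets of a finite chain

module SetOrder {n : ℕ} (_⊏_ : Rel (Fin n) 0ℓ) where

  IsMax : Fin n → Subset n → Set
  IsMax a X = a ∈ X × (∀ x → x ∈ X → x ⊏ a ⊎ x ≡ a)

  infix 4 _⊏alex_ _⊏sal_

  _⊏alex_ : Rel (Subset n) 0ℓ
  X ⊏alex Y = X ⊂ Y ⊎
              (X ⊈ Y × Y ⊈ X ×
               ∃₂ λ a b → IsMax a (X ─ Y) × IsMax b (Y ─ X) × a ⊏ b)

  data _⊏sal_ (X Y : Subset n) : Set where
    empty-least : X ≡ Subset.⊥ → Y ≢ Subset.⊥ → X ⊏sal Y
    singletons  : ∀ {x y} → X ≡ ⁅ x ⁆ → Y ≡ ⁅ y ⁆ → x ⊏ y → X ⊏sal Y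
    one-many    : ∣ X ∣ ≡ 1 → 1 ℕ.< ∣ Y ∣ → X ⊏sal Y
    many-many   : 1 ℕ.< ∣ X ∣ → 1 ℕ.< ∣ Y ∣ → X ⊏alex Y → X ⊏sal Y

-- ⊏sal is a strict total order.  The proof identifies ⊏alex with ⊏colex, which
-- compares X and Y at the largest element of their symmetric difference, and
-- ⊏sal with the lexicographic order on pairs (min(|X|,2) , X).
module SetOrderProperties {n : ℕ} {_⊏_ : Rel (Fin n) 0ℓ}
                          (sto : IsStrictTotalOrder _≡_ _⊏_) where
  private module O = IsStrictTotalOrder sto
  open SetOrder _⊏_

  findMax : ∀ {n} {_<_ : Rel (Fin n) 0ℓ} → IsStrictTotalOrder _≡_ _<_ →
            {P : Pred (Fin n) 0ℓ} → Decidable P →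
            (∀ x → ¬ P x) ⊎ ∃[ a ] (P a × (∀ x → P x → x < a ⊎ x ≡ a))
  findMax {zero}  o P? = inj₁ λ ()
  findMax {suc n} {_<_} o {P} P?
    with findMax {n} {λ x y → suc x < suc y} o′ {P ∘ suc} (P? ∘ suc) | P? zero
    where
    o″ = On.isStrictTotalOrder {B = Fin n} suc o
    module o″ = IsStrictTotalOrder o″
    compare′ : Trichotomous _≡_ (λ x y → suc x < suc y)
    compare′ x y with o″.compare x y
    ... | tri< a b c = tri< a (b ∘ cong suc) c
    ... | tri≈ a b c = tri≈ a (Fin.suc-injective b) c
    ... | tri> a b c = tri> a (b ∘ cong suc) c
    o′ : IsStrictTotalOrder _≡_ (λ x y → suc x < suc y)
    o′ = isStrictTotalOrderᶜ record
      { isEquivalence = ≡.isEquivalence ; trans = o″.trans ; compare = compare′ }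
  ... | inj₁ none | no ¬p = inj₁ λ { zero → ¬p ; (suc x) → none x }
  ... | inj₁ none | yes p = inj₂ (zero , p , λ { zero _ → inj₂ refl
                                               ; (suc x) q → ⊥-elim (none x q) })
  ... | inj₂ (a , pa , la) | no ¬p =
    inj₂ (suc a , pa , λ { zero q → ⊥-elim (¬p q) ; (suc x) q → up (la x q) })
    where
    up : ∀ {x} → suc x < suc a ⊎ x ≡ a → suc x < suc a ⊎ suc x ≡ suc a
    up (inj₁ l) = inj₁ l
    up (inj₂ e) = inj₂ (cong suc e)
  ... | inj₂ (a , pa , la) | yes p with IsStrictTotalOrder.compare o zero (suc a)
  ...   | tri≈ _ () _
  ...   | tri< 0<a _ _ =
    inj₂ (suc a , pa , λ { zero q → inj₁ 0<a ; (suc x) q → up (la x q) })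
    where
    up : ∀ {x} → suc x < suc a ⊎ x ≡ a → suc x < suc a ⊎ suc x ≡ suc a
    up (inj₁ l) = inj₁ l
    up (inj₂ e) = inj₂ (cong suc e)
  ...   | tri> _ _ a<0 =
    inj₂ (zero , p , λ { zero q → inj₂ refl ; (suc x) q → inj₁ (up (la x q)) })
    where
    up : ∀ {x} → suc x < suc a ⊎ x ≡ a → suc x < zero
    up (inj₁ l)    = IsStrictTotalOrder.trans o l a<0
    up (inj₂ refl) = a<0

  x∈p─q⇒x∉q : ∀ {n x} (p q : Subset n) → x ∈ p ─ q → x ∉ q
  x∈p─q⇒x∉q (_ ∷ p) (_ ∷ q) (there i) (there j) = x∈p─q⇒x∉q p q i j
  x∈p─q⇒x∉q (_ ∷ p) (.inside ∷ q) () here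

  infix 4 _⊏colex_
  _⊏colex_ : Rel (Subset n) 0ℓ
  X ⊏colex Y = ∃[ a ] (a ∈ Y × a ∉ X ×
               (∀ x → a ⊏ x → (x ∈ X → x ∈ Y) × (x ∈ Y → x ∈ X)))

  alex⇒colex : ∀ {X Y} → X ⊏alex Y → X ⊏colex Y
  alex⇒colex {X} {Y} (inj₁ (X⊆Y , a , a∈Y , a∉X))
    with findMax sto (_∈? (Y ─ X))
  ... | inj₁ none = ⊥-elim (none a (x∈p∧x∉q⇒x∈p─q a∈Y a∉X))
  ... | inj₂ (b , b∈ , lb) =
    b , p─q⊆p Y X b∈ , x∈p─q⇒x∉q Y X b∈ , λ x b⊏x → X⊆Y , back x b⊏x
    where
    back : ∀ x → b ⊏ x → x ∈ Y → x ∈ X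
    back x b⊏x x∈Y with x ∈? X
    ... | yes x∈X = x∈X
    ... | no  x∉X with lb x (x∈p∧x∉q⇒x∈p─q x∈Y x∉X)
    ...   | inj₁ x⊏b  = ⊥-elim (O.asym b⊏x x⊏b)
    ...   | inj₂ refl = ⊥-elim (O.irrefl refl b⊏x)
  alex⇒colex {X} {Y} (inj₂ (_ , _ , a , b , (a∈ , la) , (b∈ , lb) , a⊏b)) =
    b , p─q⊆p Y X b∈ , x∈p─q⇒x∉q Y X b∈ , λ x b⊏x → forth x b⊏x , back x b⊏x
    where
    back : ∀ x → b ⊏ x → x ∈ Y → x ∈ X
    back x b⊏x x∈Y with x ∈? X
    ... | yes x∈X = x∈X
    ... | no  x∉X with lb x (x∈p∧x∉q⇒x∈p─q x∈Y x∉X)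
    ...   | inj₁ x⊏b  = ⊥-elim (O.asym b⊏x x⊏b)
    ...   | inj₂ refl = ⊥-elim (O.irrefl refl b⊏x)
    forth : ∀ x → b ⊏ x → x ∈ X → x ∈ Y
    forth x b⊏x x∈X with x ∈? Y
    ... | yes x∈Y = x∈Y
    ... | no  x∉Y with la x (x∈p∧x∉q⇒x∈p─q x∈X x∉Y)
    ...   | inj₁ x⊏a  = ⊥-elim (O.asym b⊏x (O.trans x⊏a a⊏b))
    ...   | inj₂ refl = ⊥-elim (O.asym b⊏x a⊏b)

  colex⇒alex : ∀ {X Y} → X ⊏colex Y → X ⊏alex Y
  colex⇒alex {X} {Y} (a , a∈Y , a∉X , agree)
    with findMax sto (_∈? (X ─ Y)) | findMax sto (_∈? (Y ─ X))
  ... | inj₁ none | _ = inj₁ (X⊆Y , a , a∈Y , a∉X)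
    where
    X⊆Y : X ⊆ Y
    X⊆Y {x} x∈X with x ∈? Y
    ... | yes x∈Y = x∈Y
    ... | no  x∉Y = ⊥-elim (none x (x∈p∧x∉q⇒x∈p─q x∈X x∉Y))
  ... | inj₂ _ | inj₁ none = ⊥-elim (none a (x∈p∧x∉q⇒x∈p─q a∈Y a∉X))
  ... | inj₂ (p , p∈ , lp) | inj₂ (q , q∈ , lq) =
    inj₂ ( (λ X⊆Y → p∉Y (X⊆Y p∈X)) , (λ Y⊆X → a∉X (Y⊆X a∈Y))
         , p , q , (p∈ , lp) , (q∈ , lq) , p⊏q )
    where
    p∈X = p─q⊆p X Y p∈
    p∉Y = x∈p─q⇒x∉q X Y p∈
    p⊏a : p ⊏ a
    p⊏a with O.compare p a
    ... | tri< l _ _    = l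
    ... | tri≈ _ refl _ = ⊥-elim (a∉X p∈X)
    ... | tri> _ _ a⊏p  = ⊥-elim (p∉Y (proj₁ (agree p a⊏p) p∈X))
    p⊏q : p ⊏ q
    p⊏q with lq a (x∈p∧x∉q⇒x∈p─q a∈Y a∉X)
    ... | inj₁ a⊏q  = O.trans p⊏a a⊏q
    ... | inj₂ refl = p⊏a

  colex-trans : ∀ {X Y Z} → X ⊏colex Y → Y ⊏colex Z → X ⊏colex Z
  colex-trans (a , a∈Y , a∉X , f) (b , b∈Z , b∉Y , g) with O.compare a b
  ... | tri≈ _ refl _ = ⊥-elim (b∉Y a∈Y)
  ... | tri< a⊏b _ _  =
    b , b∈Z , (λ b∈X → b∉Y (proj₁ (f b a⊏b) b∈X)) , λ x b⊏x →
      let a⊏x = O.trans a⊏b b⊏x in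
      proj₁ (g x b⊏x) ∘ proj₁ (f x a⊏x) , proj₂ (f x a⊏x) ∘ proj₂ (g x b⊏x)
  ... | tri> _ _ b⊏a  =
    a , proj₁ (g a b⊏a) a∈Y , a∉X , λ x a⊏x →
      let b⊏x = O.trans b⊏a a⊏x in
      proj₁ (g x b⊏x) ∘ proj₁ (f x a⊏x) , proj₂ (f x a⊏x) ∘ proj₂ (g x b⊏x)

  colex-irrefl : ∀ {X} → ¬ (X ⊏colex X)
  colex-irrefl (_ , a∈X , a∉X , _) = a∉X a∈X

  colex-compare : Trichotomous _≡_ _⊏colex_
  colex-compare X Y with findMax sto (_∈? ((X ─ Y) ∪ (Y ─ X)))
  ... | inj₁ none = tri≈ irr X≡Y (λ l → irr (subst₂ _⊏colex_ (sym X≡Y) X≡Y l))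
    where
    sub : ∀ {x} (P Q : Subset n) → (x ∈ P ─ Q → ¬ (x ∈ P ─ Q)) → x ∈ P → x ∈ Q
    sub {x} P Q h x∈P with x ∈? Q
    ... | yes x∈Q = x∈Q
    ... | no  x∉Q = let i = x∈p∧x∉q⇒x∈p─q x∈P x∉Q in ⊥-elim (h i i)
    X≡Y : X ≡ Y
    X≡Y = ⊆-antisym
      (λ {x} → sub X Y (λ i _ → none x (x∈p∪q⁺ (inj₁ i))))
      (λ {x} → sub Y X (λ i _ → none x (x∈p∪q⁺ (inj₂ i))))
    irr : ¬ (X ⊏colex Y)
    irr l = colex-irrefl (subst (X ⊏colex_) (sym X≡Y) l)
  ... | inj₂ (a , a∈ , la) = decide (x∈p∪q⁻ (X ─ Y) (Y ─ X) a∈)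
    where
    above : ∀ x → a ⊏ x → ¬ (x ∈ (X ─ Y) ∪ (Y ─ X))
    above x a⊏x i with la x i
    ... | inj₁ x⊏a  = O.asym a⊏x x⊏a
    ... | inj₂ refl = O.irrefl refl a⊏x
    XY : ∀ x → a ⊏ x → x ∈ X → x ∈ Y
    XY x a⊏x x∈X with x ∈? Y
    ... | yes x∈Y = x∈Y
    ... | no  x∉Y = ⊥-elim (above x a⊏x (x∈p∪q⁺ (inj₁ (x∈p∧x∉q⇒x∈p─q x∈X x∉Y))))
    YX : ∀ x → a ⊏ x → x ∈ Y → x ∈ X
    YX x a⊏x x∈Y with x ∈? X
    ... | yes x∈X = x∈X
    ... | no  x∉X = ⊥-elim (above x a⊏x (x∈p∪q⁺ (inj₂ (x∈p∧x∉q⇒x∈p─q x∈Y x∉X))))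
    decide : a ∈ X ─ Y ⊎ a ∈ Y ─ X → _
    decide (inj₁ i) = tri> (λ l → colex-irrefl (colex-trans l Y<X))
                           (λ { refl → colex-irrefl Y<X }) Y<X
      where
      Y<X : Y ⊏colex X
      Y<X = a , p─q⊆p X Y i , x∈p─q⇒x∉q X Y i , λ x l → YX x l , XY x l
    decide (inj₂ i) = tri< X<Y (λ { refl → colex-irrefl X<Y })
                           (λ l → colex-irrefl (colex-trans l X<Y))
      where
      X<Y : X ⊏colex Y
      X<Y = a , p─q⊆p Y X i , x∈p─q⇒x∉q Y X i , λ x l → XY x l , YX x l

  colex-isStrictTotalOrder : IsStrictTotalOrder _≡_ _⊏colex_
  colex-isStrictTotalOrder = isStrictTotalOrderᶜ record
    { isEquivalence = ≡.isEquivalence ; trans = colex-trans ; compare = colex-compare }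

  ∣p∣≡0⇒p≡⊥ : ∀ {n} (p : Subset n) → ∣ p ∣ ≡ 0 → p ≡ Subset.⊥
  ∣p∣≡0⇒p≡⊥ []            _  = refl
  ∣p∣≡0⇒p≡⊥ (outside ∷ p) eq = cong (outside ∷_) (∣p∣≡0⇒p≡⊥ p eq)

  ∣p∣≡1⇒p≡⁅x⁆ : ∀ {n} (p : Subset n) → ∣ p ∣ ≡ 1 → ∃[ x ] p ≡ ⁅ x ⁆
  ∣p∣≡1⇒p≡⁅x⁆ (inside  ∷ p) eq =
    zero , cong (inside ∷_) (∣p∣≡0⇒p≡⊥ p (ℕ.suc-injective eq))
  ∣p∣≡1⇒p≡⁅x⁆ (outside ∷ p) eq =
    let x , p≡ = ∣p∣≡1⇒p≡⁅x⁆ p eq in suc x , cong (outside ∷_) p≡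

  rank : Subset n → ℕ
  rank X = ∣ X ∣ ℕ.⊓ 2

  rank-many : ∀ {X} → 1 ℕ.< ∣ X ∣ → rank X ≡ 2
  rank-many = ℕ.m≥n⇒m⊓n≡n

  rank-one : ∀ {X} → ∣ X ∣ ≡ 1 → rank X ≡ 1
  rank-one = cong (ℕ._⊓ 2)

  infix 4 _⊏lex_
  _⊏lex_ : Rel (Subset n) 0ℓ
  X ⊏lex Y = rank X ℕ.< rank Y ⊎ (rank X ≡ rank Y × X ⊏colex Y)

  colex-⁅⁆⁺ : ∀ {x y} → x ⊏ y → ⁅ x ⁆ ⊏colex ⁅ y ⁆
  colex-⁅⁆⁺ {x} {y} x⊏y =
    y , x∈⁅x⁆ y , (λ i → O.irrefl (sym (x∈⁅y⁆⇒x≡y x i)) x⊏y) , λ z y⊏z →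
      (λ i → ⊥-elim (O.asym x⊏y (subst (y ⊏_) (x∈⁅y⁆⇒x≡y x i) y⊏z))) ,
      (λ i → ⊥-elim (O.irrefl (sym (x∈⁅y⁆⇒x≡y y i)) y⊏z))

  colex-⁅⁆⁻ : ∀ {x y} → ⁅ x ⁆ ⊏colex ⁅ y ⁆ → x ⊏ y
  colex-⁅⁆⁻ {x} {y} l with O.compare x y
  ... | tri< x⊏y _ _  = x⊏y
  ... | tri≈ _ refl _ = ⊥-elim (colex-irrefl l)
  ... | tri> _ _ y⊏x  = ⊥-elim (colex-irrefl (colex-trans l (colex-⁅⁆⁺ y⊏x)))

  sal⇒lex : ∀ {X Y} → X ⊏sal Y → X ⊏lex Y
  sal⇒lex {Y = Y} (empty-least refl Y≢⊥) rewrite ∣⊥∣≡0 n with ∣ Y ∣ in eq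
  ... | zero        = ⊥-elim (Y≢⊥ (∣p∣≡0⇒p≡⊥ Y eq))
  ... | suc zero    = inj₁ (s≤s z≤n)
  ... | suc (suc _) = inj₁ (s≤s z≤n)
  sal⇒lex (singletons {x} {y} refl refl x⊏y) =
    inj₂ (cong (ℕ._⊓ 2) (trans (∣⁅x⁆∣≡1 x) (sym (∣⁅x⁆∣≡1 y))) , colex-⁅⁆⁺ x⊏y)
  sal⇒lex {X} {Y} (one-many p q) =
    inj₁ (subst₂ ℕ._<_ (sym (rank-one {X} p)) (sym (rank-many {Y} q)) (s≤s (s≤s z≤n)))
  sal⇒lex {X} {Y} (many-many p q l) =
    inj₂ (trans (rank-many {X} p) (sym (rank-many {Y} q)) , alex⇒colex l)

  data Size (X : Subset n) : Set where
    none : X ≡ Subset.⊥ → rank X ≡ 0 → Size X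
    one  : ∀ x → X ≡ ⁅ x ⁆ → rank X ≡ 1 → ∣ X ∣ ≡ 1 → Size X
    many : 1 ℕ.< ∣ X ∣ → rank X ≡ 2 → Size X

  sizeOf : ∀ X → Size X
  sizeOf X = go ∣ X ∣ refl
    where
    go : ∀ k → ∣ X ∣ ≡ k → Size X
    go zero          eq = none (∣p∣≡0⇒p≡⊥ X eq) (cong (ℕ._⊓ 2) eq)
    go (suc zero)    eq = let x , X≡ = ∣p∣≡1⇒p≡⁅x⁆ X eq in
                          one x X≡ (rank-one {X} eq) eq
    go (suc (suc k)) eq = let l = subst (1 ℕ.<_) (sym eq) (s≤s (s≤s z≤n)) in
                          many l (rank-many {X} l)

  nonempty-rank : ∀ {X k} → rank X ≡ suc k → X ≢ Subset.⊥
  nonempty-rank eq refl rewrite ∣⊥∣≡0 n = contradiction eq λ ()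

  lex⇒sal : ∀ {X Y} → X ⊏lex Y → X ⊏sal Y
  lex⇒sal {X} {Y} l with sizeOf X | sizeOf Y
  ... | none p _ | one _ _ r _ = empty-least p (nonempty-rank r)
  ... | none p _ | many _ r    = empty-least p (nonempty-rank r)
  ... | one _ _ _ p | many q _ = one-many p q
  lex⇒sal (inj₂ (_ , l)) | none refl _ | none refl _ = ⊥-elim (colex-irrefl l)
  lex⇒sal (inj₁ l) | none _ p | none _ q = ⊥-elim (ℕ.<-irrefl (trans p (sym q)) l)
  lex⇒sal (inj₁ l) | one _ _ p _ | one _ _ q _ = ⊥-elim (ℕ.<-irrefl (trans p (sym q)) l)
  lex⇒sal (inj₂ (_ , l)) | one _ refl _ _ | one _ refl _ _ =
    singletons refl refl (colex-⁅⁆⁻ l)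
  lex⇒sal (inj₁ l) | many _ p | many _ q = ⊥-elim (ℕ.<-irrefl (trans p (sym q)) l)
  lex⇒sal (inj₂ (_ , l)) | many p _ | many q _ = many-many p q (colex⇒alex l)
  lex⇒sal (inj₁ l) | one _ _ p _ | none _ q = contradiction (subst₂ ℕ._<_ p q l) λ ()
  lex⇒sal (inj₂ (e , _)) | one _ _ p _ | none _ q =
    contradiction (trans (sym p) (trans e q)) λ ()
  lex⇒sal (inj₁ l) | many _ p | none _ q = contradiction (subst₂ ℕ._<_ p q l) λ ()
  lex⇒sal (inj₂ (e , _)) | many _ p | none _ q =
    contradiction (trans (sym p) (trans e q)) λ ()
  lex⇒sal (inj₁ l) | many _ p | one _ _ q _ =
    contradiction (subst₂ ℕ._<_ p q l) λ { (s≤s ()) }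
  lex⇒sal (inj₂ (e , _)) | many _ p | one _ _ q _ =
    contradiction (trans (sym p) (trans e q)) λ ()

  sal-isStrictTotalOrder : IsStrictTotalOrder _≡_ _⊏sal_
  sal-isStrictTotalOrder = isStrictTotalOrderᶜ record
    { isEquivalence = ≡.isEquivalence
    ; trans         = λ p q → lex⇒sal (L.trans (sal⇒lex p) (sal⇒lex q))
    ; compare       = compare
    }
    where
    module L = IsStrictTotalOrder
      (On.isStrictTotalOrder (λ (X : Subset n) → rank X , X)
        (×-isStrictTotalOrder ℕ.<-isStrictTotalOrder colex-isStrictTotalOrder))
    compare : Trichotomous _≡_ _⊏sal_
    compare X Y with L.compare X Y
    ... | tri< a b c = tri< (lex⇒sal a) (λ { refl → b (refl , refl) }) (c ∘ sal⇒lex)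
    ... | tri≈ a b c = tri≈ (a ∘ sal⇒lex) (proj₂ b) (c ∘ sal⇒lex)
    ... | tri> a b c = tri> (a ∘ sal⇒lex) (λ { refl → b (refl , refl) }) (lex⇒sal c)

------------------------------------------------------------------------
-- Direct images

-- image f e = { f x ∣ x ∈ e }
image : (Fin n → Fin m) → Subset n → Subset m
image f e = tabulate λ y → does (Fin.any? λ x → (x ∈? e) ×-dec (f x Fin.≟ y))

∈-image⁺ : ∀ (f : Fin n → Fin m) (e : Subset n) {x} → x ∈ e → f x ∈ image f e
∈-image⁺ f e {x} x∈e = lookup⇒[]= (f x) _
  (trans (lookup∘tabulate _ (f x)) (dec-true (Fin.any? _) (x , x∈e , refl)))

∈-image⁻ : ∀ (f : Fin n → Fin m) (e : Subset n) {y} →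
           y ∈ image f e → ∃[ x ] (x ∈ e × f x ≡ y)
∈-image⁻ f e {y} y∈ =
  fromDoes (Fin.any? _) (trans (sym (lookup∘tabulate _ y)) ([]=⇒lookup y∈))
  where
  fromDoes : ∀ {p} {P : Set p} (d : Dec P) → does d ≡ true → P
  fromDoes (yes p) _ = p

image-id : ∀ (e : Subset n) → image id e ≡ e
image-id e = ⊆-antisym
  (λ i → let x , x∈e , x≡y = ∈-image⁻ id e i in subst (_∈ e) x≡y x∈e)
  (∈-image⁺ id e)

image-∘ : ∀ (g : Fin m → Fin k) (f : Fin n → Fin m) e →
          image (g ∘′ f) e ≡ image g (image f e)
image-∘ g f e = ⊆-antisym
  (λ i → let x , x∈e , gfx≡y = ∈-image⁻ (g ∘′ f) e i in
         subst (_∈ image g (image f e)) gfx≡y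
           (∈-image⁺ g (image f e) (∈-image⁺ f e x∈e)))
  (λ i → let y , y∈ , gy≡z = ∈-image⁻ g (image f e) i
             x , x∈e , fx≡y = ∈-image⁻ f e y∈ in
         subst (_∈ image (g ∘′ f) e) (trans (cong g fx≡y) gy≡z)
           (∈-image⁺ (g ∘′ f) e x∈e))

∣image⊤∣ : ∀ (f : Fin n → Fin m) → (∀ {i j} → f i ≡ f j → i ≡ j) →
           ∣ image f Subset.⊤ ∣ ≡ n
∣image⊤∣ {zero} {m} f _ = trans (cong ∣_∣ eq) (∣⊥∣≡0 m)
  where
  eq : image f Subset.⊤ ≡ Subset.⊥
  eq = ⊆-antisym (λ i → contradiction (proj₁ (∈-image⁻ f Subset.⊤ i)) λ ()) ⊥⊆
∣image⊤∣ {suc n} {m} f inj =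
  trans (cong ∣_∣ eq)
        (trans (∣⁅x⁆∪q∣ (f zero) rest f0∉) (cong suc (∣image⊤∣ (f ∘ suc) (Fin.suc-injective ∘ inj))))
  where
  rest = image (f ∘ suc) Subset.⊤
  f0∉ : f zero ∉ rest
  f0∉ i = let x , _ , e = ∈-image⁻ (f ∘ suc) Subset.⊤ i in
          contradiction (inj e) λ ()
  ∣⁅x⁆∪q∣ : ∀ {m} (x : Fin m) q → x ∉ q → ∣ ⁅ x ⁆ ∪ q ∣ ≡ suc ∣ q ∣
  ∣⁅x⁆∪q∣ zero    (inside  ∷ q) x∉q = ⊥-elim (x∉q here)
  ∣⁅x⁆∪q∣ zero    (outside ∷ q) x∉q = cong (suc ∘ ∣_∣) (∪-identityˡ q)
  ∣⁅x⁆∪q∣ (suc x) (inside  ∷ q) x∉q = cong suc (∣⁅x⁆∪q∣ x q (x∉q ∘ there))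
  ∣⁅x⁆∪q∣ (suc x) (outside ∷ q) x∉q = ∣⁅x⁆∪q∣ x q (x∉q ∘ there)
  eq : image f Subset.⊤ ≡ ⁅ f zero ⁆ ∪ rest
  eq = ⊆-antisym to from
    where
    to : image f Subset.⊤ ⊆ ⁅ f zero ⁆ ∪ rest
    to i with ∈-image⁻ f Subset.⊤ i
    ... | zero  , _ , refl = x∈p∪q⁺ (inj₁ (x∈⁅x⁆ _))
    ... | suc x , _ , refl = x∈p∪q⁺ (inj₂ (∈-image⁺ (f ∘ suc) Subset.⊤ (∈⊤ {x = x})))
    from : ⁅ f zero ⁆ ∪ rest ⊆ image f Subset.⊤
    from i with x∈p∪q⁻ ⁅ f zero ⁆ rest i
    ... | inj₁ j = subst (_∈ image f Subset.⊤) (sym (x∈⁅y⁆⇒x≡y _ j)) (∈-image⁺ f Subset.⊤ ∈⊤)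
    ... | inj₂ j = let x , _ , e = ∈-image⁻ (f ∘ suc) Subset.⊤ j in
                   subst (_∈ image f Subset.⊤) e (∈-image⁺ f Subset.⊤ ∈⊤)

------------------------------------------------------------------------
-- Finite linearly ordered reflexive r-uniform hypergraphs

-- The vertex set is Fin order with an arbitrary linear order ⊏, in general not
-- the numerical one.  Membership in S is decidable so that the edges really
-- form a finite set.
record OrderedHypergraph (r : ℕ) : Set₁ where
  field
    chain   : FiniteChain
  open FiniteChain chain public renaming (size to order)
  field
    S       : Pred (Subset order) 0ℓ
    S?      : Decidable S
    uniform : ∀ {e} → S e → ∣ e ∣ ≡ r

  E : Pred (Subset order) 0ℓ
  E e = ∣ e ∣ ≡ 1 ⊎ S e

  open SetOrder _⊏_ public
  open SetOrderProperties isStrictTotalOrder public using (sal-isStrictTotalOrder)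

  -- (E , ⊏sal); an edge is compared by its underlying set only.
  edges : StrictTotalOrder 0ℓ 0ℓ 0ℓ
  edges = On.strictTotalOrder
    (record { isStrictTotalOrder = sal-isStrictTotalOrder })
    (proj₁ {A = Subset order} {B = E})

private
  variable
    r : ℕ

module _ (G H : OrderedHypergraph r) where
  private
    module G = OrderedHypergraph G
    module H = OrderedHypergraph H

  IsHomomorphism : (Fin G.order → Fin H.order) → Set
  IsHomomorphism f = ∀ {e} → G.E e → H.E (image f e)

  edgeMap : ∀ f → IsHomomorphism f → Σ (Subset G.order) G.E → Σ (Subset H.order) H.E
  edgeMap f hom (e , e∈E) = image f e , hom e∈E

  ConstantOn : Subset G.order → (Fin G.order → Fin H.order) → Set
  ConstantOn e f = ∀ {x y} → x ∈ e → y ∈ e → f x ≡ f y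

  record StrongRigidQuotientMap : Set where
    field
      map    : Fin G.order → Fin H.order
      hom    : IsHomomorphism map
      rigid  : IsRigidSurjection G.edges H.edges (edgeMap map hom)
      strong : ∀ {e} → G.E e → ¬ ConstantOn e map →
               ∀ {x y} → x ∈ e → y ∈ e → x G.⊏ y → map x H.⊏ map y

private
  open StrongRigidQuotientMap

-- Rigidity depends on a map between the edge chains only up to ≈.
module _ (X : StrictTotalOrder c ℓ₁ ℓ₂) (Y : StrictTotalOrder c′ ℓ₁′ ℓ₂′) where
  private
    module X = StrictTotalOrder X
    module Y = StrictTotalOrder Y

  rigid-resp : ∀ {f g} → (∀ x → f x Y.≈ g x) →
               IsRigidSurjection X Y f → IsRigidSurjection X Y g
  rigid-resp {f} {g} f≈g F = record
    { isSurjection = record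
      { isCongruent = record
        { cong           = λ {x} {y} e →
            Y.Eq.trans (Y.Eq.sym (f≈g x)) (Y.Eq.trans (F.f-cong e) (f≈g y))
        ; isEquivalence₁ = X.isEquivalence
        ; isEquivalence₂ = Y.isEquivalence
        }
      ; surjective = λ y →
          let x , h = IsSurjection.surjective F.isSurjection y in
          x , λ {z} z≈x → Y.Eq.trans (Y.Eq.sym (f≈g z)) (h z≈x)
      }
    ; rigid = λ y<y′ →
        let x , x′ , x-min , x′-min , x<x′ = F.rigid y<y′
        in  x , x′ , conv x-min , conv x′-min , x<x′
    }
    where
    module F = IsRigidSurjection F
    conv : ∀ {y x} → IsMinPreimage X Y f y x → IsMinPreimage X Y g y x
    conv {y} {x} (fx , l) = Y.Eq.trans (Y.Eq.sym (f≈g x)) fx ,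
                            λ x′ gx′ → l x′ (Y.Eq.trans (f≈g x′) gx′)

idMap : (G : OrderedHypergraph r) → StrongRigidQuotientMap G G
idMap G = record
  { map    = id
  ; hom    = λ {e} → subst E (sym (image-id e))
  ; rigid  = rigid-resp edges edges (λ (e , _) → sym (image-id e)) (id-isRigidSurjection edges)
  ; strong = λ _ _ _ _ x⊏y → x⊏y
  }
  where open OrderedHypergraph G

compose : (G H K : OrderedHypergraph r) → StrongRigidQuotientMap H K →
          StrongRigidQuotientMap G H → StrongRigidQuotientMap G K
compose G H K g f = record
  { map    = map g ∘′ map f
  ; hom    = λ {e} e∈E → subst K.E (sym (image-∘ (map g) (map f) e)) (hom g (hom f e∈E))
  ; rigid  = rigid-resp G.edges K.edges (λ (e , _) → sym (image-∘ (map g) (map f) e))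
               (∘-isRigidSurjection G.edges H.edges K.edges (rigid f) (rigid g))
  ; strong = λ {e} e∈E nc x∈e y∈e x⊏y →
      strong g (hom f e∈E)
        (λ const → nc λ x∈ y∈ → const (∈-image⁺ (map f) e x∈) (∈-image⁺ (map f) e y∈))
        (∈-image⁺ (map f) e x∈e) (∈-image⁺ (map f) e y∈e)
        (strong f e∈E (λ const → nc λ x∈ y∈ → cong (map g) (const x∈ y∈)) x∈e y∈e x⊏y)
  }
  where
  module G = OrderedHypergraph G
  module H = OrderedHypergraph H
  module K = OrderedHypergraph K

OHgr-srq : ℕ → Category (lsuc 0ℓ) 0ℓ 0ℓ
OHgr-srq r = record
  { Obj       = OrderedHypergraph r
  ; Hom       = StrongRigidQuotientMap
  ; _≈_       = λ f g → ∀ x → map f x ≡ map g x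
  ; identity  = λ {G} → idMap G
  ; _·_       = λ {G} {H} {K} → compose G H K
  ; equiv     = record
    { refl  = λ _ → refl
    ; sym   = λ p x → sym (p x)
    ; trans = λ p q x → trans (p x) (q x)
    }
  ; assoc     = λ _ → refl
  ; identityˡ = λ _ → refl
  ; identityʳ = λ _ → refl
  ; ·-resp-≈  = λ {_} {_} {_} {f} {f′} {g} {g′} p q x →
                  trans (cong (map f) (q x)) (p (map g′ x))
  }

OGra-srq : Category (lsuc 0ℓ) 0ℓ 0ℓ
OGra-srq = OHgr-srq 2

------------------------------------------------------------------------
-- The hypergraph r ⊠ L: the pair (i , ℓ) is coded as combine i ℓ

module _ (r : ℕ) (L : FiniteChain) where
  private
    module L = FiniteChain L
    module ⊏ = IsStrictTotalOrder L.isStrictTotalOrder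

    pair : Fin (r ℕ.* L.size) → Fin r × Fin L.size
    pair = remQuot L.size

    pair-injective : ∀ {u v} → pair u ≡ pair v → u ≡ v
    pair-injective {u} {v} eq =
      trans (sym (Fin.combine-remQuot {r} L.size u))
            (trans (cong (λ p → combine (proj₁ p) (proj₂ p)) eq)
                   (Fin.combine-remQuot {r} L.size v))

  infix 4 _≺_
  _≺_ : Rel (Fin (r ℕ.* L.size)) 0ℓ
  u ≺ v = let i , ℓ = remQuot {r} L.size u
              j , k = remQuot {r} L.size v
          in ℓ L.⊏ k ⊎ (ℓ ≡ k × i Fin.< j)

  ≺-isStrictTotalOrder : IsStrictTotalOrder _≡_ _≺_
  ≺-isStrictTotalOrder = isStrictTotalOrderᶜ record
    { isEquivalence = ≡.isEquivalence ; trans = λ {u} {v} {w} → Lex.trans {u} {v} {w}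
    ; compare = compare }
    where
    swapped : Fin (r ℕ.* L.size) → Fin L.size × Fin r
    swapped u = proj₂ (pair u) , proj₁ (pair u)
    module Lex = IsStrictTotalOrder
      (On.isStrictTotalOrder swapped
        (×-isStrictTotalOrder L.isStrictTotalOrder Fin.<-isStrictTotalOrder))
    compare : Trichotomous _≡_ _≺_
    compare u v with Lex.compare u v
    ... | tri< a b c         = tri< a (λ { refl → b (refl , refl) }) c
    ... | tri≈ a (p , q) c   = tri≈ a (pair-injective (cong₂ _,_ q p)) c
    ... | tri> a b c         = tri> a (λ { refl → b (refl , refl) }) c

  -- { (1,ℓ) , … , (r,ℓ) }
  column : Fin L.size → Subset (r ℕ.* L.size)
  column ℓ = image (λ (i : Fin r) → combine i ℓ) Subset.⊤

  ∣column∣ : ∀ ℓ → ∣ column ℓ ∣ ≡ r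
  ∣column∣ ℓ = ∣image⊤∣ (λ i → combine i ℓ)
                 (λ {i} {j} → Fin.combine-injectiveˡ i ℓ j ℓ)

  infix 7 _⊠_
  _⊠_ : OrderedHypergraph r
  _⊠_ = record
    { chain   = record
      { size = r ℕ.* L.size ; _⊏_ = _≺_ ; isStrictTotalOrder = ≺-isStrictTotalOrder }
    ; S       = λ e → ∃[ ℓ ] e ≡ column ℓ
    ; S?      = λ e → Fin.any? λ ℓ → e ≟ˢ column ℓ
    ; uniform = λ { (ℓ , refl) → ∣column∣ ℓ }
    }
    where
    _≟ˢ_ : (p q : Subset (r ℕ.* L.size)) → Dec (p ≡ q)
    _≟ˢ_ = ≡-dec Bool._≟_

------------------------------------------------------------------------
-- Bipartite and Kₙ-free graphs (loops are ignored)

module _ (G : OrderedHypergraph 2) where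
  open OrderedHypergraph G

  Adjacent : Rel (Fin order) 0ℓ
  Adjacent x y = x ≢ y × E (⁅ x ⁆ ∪ ⁅ y ⁆)

  Bipartite : Set
  Bipartite = ∃[ X ] (∀ {x y} → Adjacent x y → (x ∈ X × y ∉ X) ⊎ (x ∉ X × y ∈ X))

  Clique : Subset order → Set
  Clique K = ∀ {x y} → x ∈ K → y ∈ K → x ≢ y → Adjacent x y

  KFree : ℕ → Set
  KFree n = ¬ (∃[ K ] (∣ K ∣ ≡ n × Clique K))

{-# OPTIONS --safe #-}

-- A strong rigid quotient map r ⊠ L → A is determined by the images of the
-- columns, which form a word over the edges of A.  Every rigid surjection from L
-- onto (E A , ⊏sal) arises in this way, and postcomposition with f : B → A
-- becomes postcomposition with the rigid surjection E B → E A induced by f.  So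
-- the dual Ramsey property reduces to the dual Ramsey theorem for finite chains,
-- i.e. to the Graham–Rothschild theorem for parameter words without letters.
-- That theorem follows from the Hales–Jewett theorem by induction on the number
-- of parameters, the first parameter becoming a letter once it has occurred; the
-- Hales–Jewett theorem is obtained by Shelah's argument.

module Submission where

open import Level using (Level; 0ℓ)
open import Data.Empty using (⊥-elim)
open import Data.Fin.Base as Fin using (Fin; zero; suc; funToFin; finToFun; combine; remQuot)
import Data.Fin.Properties as Fin
open import Data.Fin.Subset as Subset using (Subset; inside; outside; _∈_; _∉_; ∣_∣; ⁅_⁆; _∪_)
open import Data.Fin.Subset.Properties
open import Data.List.Base as List using (List; []; _∷_)
open import Data.List.Membership.Propositional using () renaming (_∈_ to _∈ˡ_)
open import Data.List.Membership.Propositional.Properties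
  using (∈-++⁺ˡ; ∈-++⁺ʳ; ∈-map⁺; ∈-filter⁺; ∈-lookup; ∈-allFin)
open import Data.List.Relation.Unary.All as All using (All; []; _∷_)
open import Data.List.Relation.Unary.All.Properties using (all-filter)
open import Data.List.Relation.Unary.AllPairs using (AllPairs; []; _∷_)
open import Data.List.Relation.Unary.Any as Any using (here; there)
open import Data.List.Relation.Unary.Any.Properties using (lookup-index)
open import Data.Nat.Base as ℕ using (ℕ; zero; suc; z≤n; s≤s; _+_; _*_; _^_; _≤_; _<_)
import Data.Nat.Properties as ℕ
open import Data.Product.Base using (Σ; ∃₂; ∃-syntax; _×_; _,_; proj₁; proj₂)
open import Data.Sum.Base using (_⊎_; inj₁; inj₂)
open import Data.Vec.Base using ([]; _∷_)
open import Data.Vec.Functional using () renaming (_∷_ to _◂_)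
open import Function.Base using (_∘_; id; const)
open import Function.Bundles using (Func; module Func)
open import Function.Structures using (IsSurjection)
open import Relation.Binary.Bundles using (StrictTotalOrder)
open import Relation.Binary.Core using (Rel)
open import Relation.Binary.Definitions using (tri<; tri≈; tri>)
open import Relation.Binary.PropositionalEquality
open import Relation.Binary.Structures using (IsStrictTotalOrder)
open import Relation.Nullary using (¬_; Dec; yes; no; contradiction)
open import Relation.Nullary.Decidable using (_⊎-dec_)
open import Relation.Unary using (Pred; Decidable)
open import Defs

-- A word records only the images of the columns, whereas rigidity also concerns the loops. The
-- order `⊏sal` reconciles the two: among the edges only smaller loops precede the loop at a vertex
-- `v`, so the columns before the first one sent to that loop go to loops elsewhere and miss `v`.
-- The least loop sent to it is therefore the one at the first vertex of that column. An edge with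
-- more than one vertex has only columns as preimages, since loops go to loops. The Hales-Jewett
-- theorem serves twice: as the case of no parameters and, in the induction step, to level the
-- colours of the letters in front of the first parameter.

private
  variable
    k l m n r s t u : ℕ
    p : Level
    X Y : Set

-- Parameter words and their substitution

-- PWord t k n is the set of k-parameter words of length n over the alphabet
-- Fin t, whose parameters first occur in their order.  After its first
-- occurrence (new) a parameter counts as the letter zero of a larger alphabet.
infixr 5 _∷_
data PWord : ℕ → ℕ → ℕ → Set where
  []  : PWord t 0 0
  _∷_ : Fin t → PWord t k n → PWord t k (suc n)
  new : PWord (suc t) k n → PWord t (suc k) (suc n)

-- sub σ h g renames the letters of h by σ and replaces its parameters by the
-- letters and parameters of g.
sub : (Fin s → Fin t) → PWord s m n → PWord t k m → PWord t k n
sub σ []      g       = g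
sub σ (a ∷ h) g       = σ a ∷ sub σ h g
sub σ (new h) (b ∷ g) = b ∷ sub (b ◂ σ) h g
sub σ (new h) (new g) = new (sub (zero ◂ (suc ∘ σ)) h g)

infixr 9 _⊙_
_⊙_ : PWord t m n → PWord t k m → PWord t k n
_⊙_ = sub id

ι : PWord t n n
ι {n = zero}  = []
ι {n = suc _} = new ι

rename : (Fin s → Fin t) → PWord s k n → PWord t k n
rename σ h = sub σ h ι

-- The composite renaming `υ` is tied to `σ` and `τ` pointwise because under `new` the extensions by
-- `◂` compose correctly in values only, not as functions.
sub-assoc : ∀ {σ : Fin s → Fin t} {τ : Fin t → Fin u} {υ : Fin s → Fin u} →
            (∀ i → τ (σ i) ≡ υ i) →
            (h : PWord s m n) (g : PWord t l m) (f : PWord u k l) →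
            sub τ (sub σ h g) f ≡ sub υ h (sub τ g f)
sub-assoc eq []      g       f       = refl
sub-assoc eq (a ∷ h) g       f       = cong₂ _∷_ (eq a) (sub-assoc eq h g f)
sub-assoc eq (new h) (b ∷ g) f       =
  cong (_ ∷_) (sub-assoc (λ { zero → refl ; (suc i) → eq i }) h g f)
sub-assoc eq (new h) (new g) (b ∷ f) =
  cong (_ ∷_) (sub-assoc (λ { zero → refl ; (suc i) → eq i }) h g f)
sub-assoc eq (new h) (new g) (new f) =
  cong new (sub-assoc (λ { zero → refl ; (suc i) → cong suc (eq i) }) h g f)

sub-cong : ∀ {σ τ : Fin s → Fin t} → (∀ i → σ i ≡ τ i) →
           (h : PWord s m n) (g : PWord t k m) → sub σ h g ≡ sub τ h g
sub-cong eq []      g       = refl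
sub-cong eq (a ∷ h) g       = cong₂ _∷_ (eq a) (sub-cong eq h g)
sub-cong eq (new h) (b ∷ g) =
  cong (_ ∷_) (sub-cong (λ { zero → refl ; (suc i) → eq i }) h g)
sub-cong eq (new h) (new g) =
  cong new (sub-cong (λ { zero → refl ; (suc i) → cong suc (eq i) }) h g)

sub-ι : (σ : Fin s → Fin t) (g : PWord t k m) → sub σ ι g ≡ g
sub-ι σ []      = refl
sub-ι σ (b ∷ g) = cong (b ∷_) (sub-ι _ g)
sub-ι σ (new g) = cong new (sub-ι _ g)

⊙-assoc : (h : PWord t m n) (g : PWord t l m) (f : PWord t k l) →
          (h ⊙ g) ⊙ f ≡ h ⊙ (g ⊙ f)
⊙-assoc = sub-assoc (λ _ → refl)

sub-rename : ∀ {σ : Fin s → Fin t} {τ : Fin t → Fin u} {υ : Fin s → Fin u} →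
             (∀ i → τ (σ i) ≡ υ i) → (h : PWord s m n) (f : PWord u k m) →
             sub τ (rename σ h) f ≡ sub υ h f
sub-rename {τ = τ} {υ} eq h f =
  trans (sub-assoc eq h ι f) (cong (sub υ h) (sub-ι τ f))

new-⊙-new : (h : PWord (suc t) m n) (g : PWord (suc t) k m) →
            new h ⊙ new g ≡ new (h ⊙ g)
new-⊙-new h g = cong new (sub-cong (λ { zero → refl ; (suc i) → refl }) h g)

Word : ℕ → ℕ → Set
Word t n = PWord t 0 n

infixr 5 _++_
_++_ : Word t n → PWord t k m → PWord t k (n + m)
[]      ++ w = w
(a ∷ v) ++ w = a ∷ (v ++ w)

-- Concatenation that keeps the two sets of parameters apart: behind its first occurrence a
-- parameter of `h` is the letter `zero`, so `σ` is shifted past it and `g` never mentions it.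
join : PWord s k n → (Fin t → Fin s) → PWord t l m → PWord s (k + l) (n + m)
join []      σ g = rename σ g
join (a ∷ h) σ g = a ∷ join h σ g
join (new h) σ g = new (join h (suc ∘ σ) g)

sub-join : ∀ {σ : Fin t → Fin s} {τ : Fin s → Fin u} {υ : Fin t → Fin u} →
           (∀ i → τ (σ i) ≡ υ i) →
           (h : PWord s k n) (g : PWord t l m) (v : Word u k) (w : Word u l) →
           sub τ (join h σ g) (v ++ w) ≡ sub τ h v ++ sub υ g w
sub-join eq []      g []      w = sub-rename eq g w
sub-join eq (a ∷ h) g v       w = cong (_ ∷_) (sub-join eq h g v w)
sub-join eq (new h) g (b ∷ v) w = cong (b ∷_) (sub-join eq h g v w)

-- The Hales–Jewett theorem

-- The given colour is the answer if there are no words w.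
HalesJewett : ℕ → Set
HalesJewett t = ∀ c → Fin c → ∀ m → ∃[ n ] ((χ : Word t n → Fin c) →
  ∃₂ λ (h : PWord t m n) col → ∀ w → χ (h ⊙ w) ≡ col)

-- This is `c` to the power `t ^ n`, the number of colourings of the words of length `n`. As an
-- iterated power it lets `funToFin` encode a colouring letter by letter.
tables : ℕ → ℕ → ℕ → ℕ
tables t zero    c = c
tables t (suc n) c = tables t n c ^ t

encode : ∀ {c} → (Word t n → Fin c) → Fin (tables t n c)
encode {n = zero}  χ = χ []
encode {n = suc n} χ = funToFin λ a → encode (χ ∘ (a ∷_))

decode : ∀ {c} → Fin (tables t n c) → Word t n → Fin c
decode i []      = i
decode i (a ∷ w) = decode (finToFun i a) w

decode-encode : ∀ {c} (χ : Word t n → Fin c) w → decode (encode χ) w ≡ χ w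
decode-encode χ []      = refl
decode-encode χ (a ∷ w) =
  trans (cong (λ i → decode i w) (Fin.finToFun-funToFin (λ a → encode (χ ∘ (a ∷_))) a))
        (decode-encode (χ ∘ (a ∷_)) w)

constant : Fin t → ∀ n → Word t n
constant a zero    = []
constant a (suc n) = a ∷ constant a n

-- step i = 0ⁱ1ⁿ⁻ⁱ
step : Fin (suc n) → Word (suc (suc t)) n
step {n}     zero    = constant (suc zero) n
step {suc n} (suc i) = zero ∷ step i

-- line i j = 0ⁱxʲ⁻ⁱ1ⁿ⁻ʲ
line : (i j : Fin (suc n)) → i Fin.< j → PWord (suc (suc t)) 1 n
line {suc n} zero    (suc j) _         =
  new (sub (zero ◂ λ _ → suc (suc zero)) (step {t = 0} j) [])
line {suc n} (suc i) (suc j) (s≤s i<j) = zero ∷ line i j i<j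

sub-constant : (σ : Fin s → Fin t) (a : Fin s) → ∀ n → sub σ (constant a n) [] ≡ constant (σ a) n
sub-constant σ a zero    = refl
sub-constant σ a (suc n) = cong (σ a ∷_) (sub-constant σ a n)

sub-step : ∀ {σ : Fin (suc (suc s)) → Fin (suc (suc t))} →
           σ zero ≡ zero → σ (suc zero) ≡ suc zero → (i : Fin (suc n)) →
           sub σ (step i) [] ≡ step i
sub-step {n = n}     p q zero    = trans (sub-constant _ _ n) (cong (λ a → constant a n) q)
sub-step {n = suc n} p q (suc i) = cong₂ _∷_ p (sub-step p q i)

-- Behind the `new` in `line`, the parameter is the letter `zero` and the former letter 1 is 2.
-- Setting the parameter to 1 sends both to 1, which erases the boundary at `j`.
sub-step-one : ∀ {σ : Fin (suc (suc s)) → Fin t} {a} →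
           σ zero ≡ a → σ (suc zero) ≡ a → (i : Fin (suc n)) →
           sub σ (step i) [] ≡ constant a n
sub-step-one {n = n}     p q zero    = trans (sub-constant _ _ n) (cong (λ a → constant a n) q)
sub-step-one {n = suc n} p q (suc i) = cong₂ _∷_ p (sub-step-one p q i)

line-zero : (i j : Fin (suc n)) (i<j : i Fin.< j) →
            line {t = t} i j i<j ⊙ (zero ∷ []) ≡ step j
line-zero {suc n} zero    (suc j) _         =
  cong (zero ∷_) (trans (sub-assoc (λ _ → refl) (step j) [] [])
                        (sub-step refl refl j))
line-zero {suc n} (suc i) (suc j) (s≤s i<j) = cong (zero ∷_) (line-zero i j i<j)

line-one : (i j : Fin (suc n)) (i<j : i Fin.< j) →
           line {t = t} i j i<j ⊙ (suc zero ∷ []) ≡ step i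
line-one {suc n} zero    (suc j) _         =
  cong (suc zero ∷_) (trans (sub-assoc (λ _ → refl) (step j) [] [])
                        (sub-step-one refl refl j))
line-one {suc n} (suc i) (suc j) (s≤s i<j) = cong (zero ∷_) (line-one i j i<j)

collapse : Fin (suc (suc t)) → Fin (suc t)
collapse zero    = zero
collapse (suc i) = i

-- Shelah's lemma: the colour of a word of the subspace does not change when
-- its letters 0 are replaced by 1.  On the first block the words step i are
-- more numerous than the colourings of the rest, so two of them span a line.
insensitive : ∀ t c m → ∃[ n ] ((χ : Word (suc (suc t)) n → Fin c) →
  ∃[ h ] ((w : Word (suc (suc t)) m) →
            χ (h ⊙ w) ≡ χ (h ⊙ sub (suc ∘ collapse) w [])))
insensitive t c zero    = 0 , λ χ → [] , λ { [] → refl }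
insensitive t c (suc m) =
  -- The rest is coloured by the vector of the colours for all letters put on the line of the first
  -- block, so that insensitivity there holds for each of these letters at once.
  let n₂ , rec = insensitive t (c ^ suc (suc t)) m in
  tables (suc (suc t)) n₂ c + n₂ , λ χ →
  let
    n₁ = tables (suc (suc t)) n₂ c
    block : Fin (suc n₁) → Word (suc (suc t)) n₂ → Fin c
    block = λ i w → χ (step i ++ w)
    i , j , i<j , i~j = Fin.pigeonhole (ℕ.n<1+n n₁) (encode ∘ block)
    ℓ = line i j i<j
    rows : Word (suc (suc t)) n₂ → Fin (suc (suc t)) → Fin c
    rows = λ w b → χ ((ℓ ⊙ (b ∷ [])) ++ w)
    h , h-ins = rec (funToFin ∘ rows)
    open ≡-Reasoning
    same-row : ∀ w b → rows (h ⊙ w) b ≡ rows (h ⊙ sub (suc ∘ collapse) w []) b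
    same-row = λ w b → begin
      rows (h ⊙ w) b                           ≡⟨ Fin.finToFun-funToFin (rows (h ⊙ w)) b ⟨
      finToFun (funToFin (rows (h ⊙ w))) b     ≡⟨ cong (λ x → finToFun x b) (h-ins w) ⟩
      finToFun (funToFin (rows (h ⊙ sub (suc ∘ collapse) w []))) b
        ≡⟨ Fin.finToFun-funToFin (rows (h ⊙ sub (suc ∘ collapse) w [])) b ⟩
      rows (h ⊙ sub (suc ∘ collapse) w []) b   ∎
    rows-0≡1 : ∀ w → rows w zero ≡ rows w (suc zero)
    rows-0≡1 = λ w → begin
      rows w zero                    ≡⟨ cong (λ v → χ (v ++ w)) (line-zero i j i<j) ⟩
      block j w                      ≡⟨ decode-encode (block j) w ⟨
      decode (encode (block j)) w    ≡⟨ cong (λ x → decode x w) i~j ⟨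
      decode (encode (block i)) w    ≡⟨ decode-encode (block i) w ⟩
      block i w                      ≡⟨ cong (λ v → χ (v ++ w)) (line-one i j i<j) ⟨
      rows w (suc zero)              ∎
    collapse-row : ∀ w b → rows w b ≡ rows w (suc (collapse b))
    collapse-row = λ { w zero → rows-0≡1 w ; w (suc b) → refl }
    rows-join : ∀ b w → χ (join ℓ id h ⊙ (b ∷ w)) ≡ rows (h ⊙ w) b
    rows-join = λ b w → cong χ (sub-join (λ _ → refl) ℓ h (b ∷ []) w)
  in
  join ℓ id h , λ { (b ∷ w) → begin
    χ (join ℓ id h ⊙ (b ∷ w))                                  ≡⟨ rows-join b w ⟩
    rows (h ⊙ w) b                                             ≡⟨ same-row w b ⟩
    rows (h ⊙ sub (suc ∘ collapse) w []) b                     ≡⟨ collapse-row _ b ⟩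
    rows (h ⊙ sub (suc ∘ collapse) w []) (suc (collapse b))    ≡⟨ rows-join (suc (collapse b)) _ ⟨
    χ (join ℓ id h ⊙ (suc (collapse b) ∷ sub (suc ∘ collapse) w [])) ∎ }

-- Induction on the alphabet. Where 0 may be replaced by 1, every word has the colour of a word
-- without 0, that is, of a word over one letter fewer renamed by `suc`. The induction hypothesis
-- handles those, and its length `m′` is the dimension asked of `insensitive`.
hales-jewett : ∀ t → HalesJewett t
hales-jewett zero c col zero = 0 , λ χ → [] , χ [] , λ { [] → refl }
hales-jewett zero c col (suc m) = suc m , λ χ → ι , col , λ { (() ∷ _) }
hales-jewett (suc zero) c col m = m , λ χ → ι , χ (constant zero m) , λ w →
  cong χ (trans (sub-ι id w) (unique w))
  where
  unique : (w : Word 1 n) → w ≡ constant zero n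
  unique []         = refl
  unique (zero ∷ w) = cong (zero ∷_) (unique w)
hales-jewett (suc (suc t)) c col m =
  let m′ , hj  = hales-jewett (suc t) c col m
      n  , ins = insensitive t c m′
  in n , λ χ →
  let h , h-ins = ins χ
      f , col , f-mono = hj (λ w → χ (h ⊙ sub suc w []))
      open ≡-Reasoning
  in h ⊙ rename suc f , col , λ w → begin
  χ ((h ⊙ rename suc f) ⊙ w)   ≡⟨ cong χ (⊙-assoc h (rename suc f) w) ⟩
  χ (h ⊙ (rename suc f ⊙ w))   ≡⟨ cong (χ ∘ (h ⊙_)) (sub-rename (λ _ → refl) f w) ⟩
  χ (h ⊙ sub suc f w)          ≡⟨ h-ins (sub suc f w) ⟩
  χ (h ⊙ sub (suc ∘ collapse) (sub suc f w) [])
    ≡⟨ cong (χ ∘ (h ⊙_)) (sub-assoc (λ _ → refl) f w []) ⟩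
  χ (h ⊙ sub suc f (sub (suc ∘ collapse) w []))
    ≡⟨ cong (χ ∘ (h ⊙_) ∘ sub suc f) (sub-assoc (λ _ → refl) w [] []) ⟨
  χ (h ⊙ sub suc f (sub suc (sub collapse w []) []))
    ≡⟨ cong (χ ∘ (h ⊙_)) (sub-assoc (λ _ → refl) f (sub collapse w []) []) ⟨
  χ (h ⊙ sub suc (f ⊙ sub collapse w []) [])  ≡⟨ f-mono (sub collapse w []) ⟩
  col ∎

-- The Graham–Rothschild theorem

-- The letters of a parameter word in front of its first parameter.
data Prefix (t : ℕ) : ℕ → Set where
  ●   : Prefix t (suc n)
  _∷_ : Fin t → Prefix t n → Prefix t (suc n)

prefix : PWord t (suc k) n → Prefix t n
prefix (a ∷ g) = a ∷ prefix g
prefix (new g) = ●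

psub : (Fin s → Fin t) → PWord s m n → Prefix t m → Prefix t n
psub σ (a ∷ h) p       = σ a ∷ psub σ h p
psub σ (new h) ●       = ●
psub σ (new h) (b ∷ p) = b ∷ psub (b ◂ σ) h p

-- Hence a colouring that depends on prefixes only still does so within the subspace of `h`.
prefix-sub : (σ : Fin s → Fin t) (h : PWord s m n) (g : PWord t (suc k) m) →
             prefix (sub σ h g) ≡ psub σ h (prefix g)
prefix-sub σ (a ∷ h) g       = cong (σ a ∷_) (prefix-sub σ h g)
prefix-sub σ (new h) (b ∷ g) = cong (b ∷_) (prefix-sub _ h g)
prefix-sub σ (new h) (new g) = refl

psub-sub : ∀ {σ : Fin s → Fin t} {τ : Fin t → Fin u} {υ : Fin s → Fin u} →
           (∀ i → τ (σ i) ≡ υ i) →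
           (h : PWord s m n) (g : PWord t l m) (p : Prefix u l) →
           psub τ (sub σ h g) p ≡ psub υ h (psub τ g p)
psub-sub eq []      []      ()
psub-sub eq (a ∷ h) g       p       = cong₂ _∷_ (eq a) (psub-sub eq h g p)
psub-sub eq (new h) (b ∷ g) p       =
  cong (_ ∷_) (psub-sub (λ { zero → refl ; (suc i) → eq i }) h g p)
psub-sub eq (new h) (new g) ●       = refl
psub-sub eq (new h) (new g) (b ∷ p) =
  cong (b ∷_) (psub-sub (λ { zero → refl ; (suc i) → eq i }) h g p)

GrahamRothschild : ℕ → ℕ → Set
GrahamRothschild t k = ∀ c → Fin c → ∀ m → ∃[ n ] ((χ : PWord t k n → Fin c) →
  ∃₂ λ (h : PWord t m n) col → ∀ g → χ (h ⊙ g) ≡ col)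

-- The words starting with the first parameter are made monochromatic, and the
-- vectors of the colours of a ∷ g, for a : Fin t, are treated recursively.
prefix-coloring : GrahamRothschild (suc t) k → ∀ c → Fin c → ∀ m →
  ∃[ n ] ((χ : PWord t (suc k) n → Fin c) →
  ∃₂ λ (h : PWord t m n) (ψ : Prefix t m → Fin c) → ∀ g → χ (h ⊙ g) ≡ ψ (prefix g))
prefix-coloring gr c col zero = 0 , λ χ → [] , (λ ()) , λ ()
prefix-coloring {t} gr c col (suc m) =
  let n₁ , rec  = prefix-coloring gr (c ^ t) (funToFin λ (_ : Fin t) → col) m
      n₀ , mono = gr c col n₁
  in suc n₀ , λ χ →
  let f , col₀ , f-mono = mono (χ ∘ new)
      rows = λ g a → χ (new f ⊙ (a ∷ g))
      h , ψ , h-prefix = rec (funToFin ∘ rows)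
      -- Behind the first parameter, `h` has to skip the letter `zero` that stands for it; putting a
      -- letter `a` for the parameter then gives back `h`.
      h⁺ = rename suc h
      open ≡-Reasoning
  in new f ⊙ new h⁺
   , (λ { ● → col₀ ; (a ∷ p) → finToFun (ψ p) a })
   , λ where
     (a ∷ g) → begin
       χ ((new f ⊙ new h⁺) ⊙ (a ∷ g))
         ≡⟨ cong χ (⊙-assoc (new f) (new h⁺) (a ∷ g)) ⟩
       χ (new f ⊙ (a ∷ sub (a ◂ id) h⁺ g))
         ≡⟨ cong (λ x → rows x a) (sub-rename (λ _ → refl) h g) ⟩
       rows (h ⊙ g) a
         ≡⟨ Fin.finToFun-funToFin (rows (h ⊙ g)) a ⟨
       finToFun (funToFin (rows (h ⊙ g))) a
         ≡⟨ cong (λ x → finToFun x a) (h-prefix g) ⟩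
       finToFun (ψ (prefix g)) a
         ∎
     (new g) → begin
       χ ((new f ⊙ new h⁺) ⊙ new g)  ≡⟨ cong χ (⊙-assoc (new f) (new h⁺) (new g)) ⟩
       χ (new f ⊙ (new h⁺ ⊙ new g))  ≡⟨ cong (λ x → χ (new f ⊙ x)) (new-⊙-new h⁺ g) ⟩
       χ (new f ⊙ new (h⁺ ⊙ g))      ≡⟨ cong χ (new-⊙-new f (h⁺ ⊙ g)) ⟩
       χ (new (f ⊙ (h⁺ ⊙ g)))        ≡⟨ f-mono (h⁺ ⊙ g) ⟩
       col₀                          ∎

inject : Prefix t n → Prefix t (suc n)
inject ●       = ●
inject (a ∷ p) = a ∷ inject p

full : Word t n → Prefix t (suc n)
full []      = ●
full (a ∷ w) = a ∷ full w

-- Since `●` occupies a place, a prefix in length `suc n` has at most `n` letters. With fewer it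
-- already fits into length `n`; with exactly `n` it is a word.
data View : Prefix t (suc n) → Set where
  injected : (p : Prefix t n) → View (inject p)
  longest  : (w : Word t n) → View (full w)

view : (p : Prefix t (suc n)) → View p
view {n = zero}  ●       = longest []
view {n = suc n} ●       = injected ●
view {n = suc n} (a ∷ p) with view p
... | injected q = injected (a ∷ q)
... | longest w  = longest (a ∷ w)

snocNew : PWord t k n → PWord t (suc k) (suc n)
snocNew []      = new []
snocNew (a ∷ h) = a ∷ snocNew h
snocNew (new h) = new (snocNew h)

snocLetter : PWord t k n → Fin t → PWord t k (suc n)
snocLetter []      b = b ∷ []
snocLetter (a ∷ h) b = a ∷ snocLetter h b
snocLetter (new h) b = new (snocLetter h (suc b))

psub-snocNew-full : (σ : Fin s → Fin t) (h : PWord s m n) (w : Word t m) →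
                    psub σ (snocNew h) (full w) ≡ full (sub σ h w)
psub-snocNew-full σ []      []      = refl
psub-snocNew-full σ (a ∷ h) w       = cong (σ a ∷_) (psub-snocNew-full σ h w)
psub-snocNew-full σ (new h) (b ∷ w) = cong (b ∷_) (psub-snocNew-full _ h w)

psub-snocNew-inject : (σ : Fin s → Fin t) (h : PWord s m n) (p : Prefix t m) →
                      psub σ (snocNew h) (inject p) ≡ inject (psub σ h p)
psub-snocNew-inject σ (a ∷ h) p       = cong (σ a ∷_) (psub-snocNew-inject σ h p)
psub-snocNew-inject σ (new h) ●       = refl
psub-snocNew-inject σ (new h) (b ∷ p) = cong (b ∷_) (psub-snocNew-inject _ h p)

-- The prefix stops at the first occurrence of a parameter of `h`, hence before the appended letter.
psub-snocLetter : (σ : Fin s → Fin t) (h : PWord s m n) (b : Fin s) (p : Prefix t m) →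
                  psub σ (snocLetter h b) p ≡ inject (psub σ h p)
psub-snocLetter σ (a ∷ h) b p       = cong (σ a ∷_) (psub-snocLetter σ h b p)
psub-snocLetter σ (new h) b ●       = refl
psub-snocLetter σ (new h) b (a ∷ p) = cong (a ∷_) (psub-snocLetter _ h (suc b) p)

count : ∀ {c} → Fin c → List (Fin c) → ℕ
count i = List.length ∘ List.filter (i Fin.≟_)

-- The colouring of the prefixes is made to depend on the length only, from the
-- longest prefixes downwards; d lists the colours of the lengths.
length-coloring : HalesJewett t → Fin t → ∀ c → Fin c → ∀ l →
  ∃[ n ] ((ψ : Prefix t n → Fin c) →
  ∃[ d ] (List.length d ≡ l × (∀ col m → m ≤ count col d →
  ∃[ h ] ((p : Prefix t m) → ψ (psub id h p) ≡ col))))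
length-coloring hj a c col zero =
  0 , λ ψ → [] , refl , λ { col .zero z≤n → [] , λ () }
length-coloring {t} hj a c col (suc l) =
  let n₁ , rec  = length-coloring hj a c col l
      n₀ , mono = hj c col n₁
  in suc n₀ , λ ψ →
  let f , col₀ , f-mono = mono (ψ ∘ full)
      d , ∣d∣ , sel = rec (ψ ∘ inject ∘ psub id f)
  in col₀ ∷ d , cong suc ∣d∣ , extend ψ f col₀ f-mono d sel
  where
  module _ {n₀ n₁} (ψ : Prefix t (suc n₀) → Fin c) (f : PWord t n₁ n₀) (col₀ : Fin c)
           (f-mono : ∀ w → ψ (full (f ⊙ w)) ≡ col₀) (d : List (Fin c))
           (sel : ∀ col m → m ≤ count col d →
                  ∃[ h ] ((p : Prefix t m) → ψ (inject (psub id f (psub id h p))) ≡ col)) where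
    open ≡-Reasoning

    -- The last length is discarded: a letter in the last place keeps every prefix shorter, and this
    -- is what `a` is for.
    extendLetter : ∀ col m → m ≤ count col d →
                   ∃[ h ] ((p : Prefix t m) → ψ (psub id h p) ≡ col)
    extendLetter col m m≤ =
      let h , h-mono = sel col m m≤ in
      snocLetter (f ⊙ h) a , λ p → begin
        ψ (psub id (snocLetter (f ⊙ h) a) p)     ≡⟨ cong ψ (psub-snocLetter id (f ⊙ h) a p) ⟩
        ψ (inject (psub id (f ⊙ h) p))           ≡⟨ cong (ψ ∘ inject) (psub-sub (λ _ → refl) f h p) ⟩
        ψ (inject (psub id f (psub id h p)))     ≡⟨ h-mono p ⟩
        col                                      ∎

    -- The last length is kept: with a parameter in the last place, the longest prefixes get the
    -- colour `col₀` from `f-mono` and the shorter ones from the choice of `h`.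
    extendNew : ∀ m → m ≤ count col₀ d →
                ∃[ h ] ((p : Prefix t (suc m)) → ψ (psub id h p) ≡ col₀)
    extendNew m m≤ = let h , h-mono = sel col₀ m m≤ in snocNew (f ⊙ h) , check h h-mono
      where
      check : (h : PWord t m n₁) → (∀ p → ψ (inject (psub id f (psub id h p))) ≡ col₀) →
              ∀ p → ψ (psub id (snocNew (f ⊙ h)) p) ≡ col₀
      check h h-mono p with view p
      ... | longest w  = begin
        ψ (psub id (snocNew (f ⊙ h)) (full w))   ≡⟨ cong ψ (psub-snocNew-full id (f ⊙ h) w) ⟩
        ψ (full ((f ⊙ h) ⊙ w))                   ≡⟨ cong (ψ ∘ full) (⊙-assoc f h w) ⟩
        ψ (full (f ⊙ (h ⊙ w)))                   ≡⟨ f-mono (h ⊙ w) ⟩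
        col₀                                     ∎
      ... | injected q = begin
        ψ (psub id (snocNew (f ⊙ h)) (inject q)) ≡⟨ cong ψ (psub-snocNew-inject id (f ⊙ h) q) ⟩
        ψ (inject (psub id (f ⊙ h) q))           ≡⟨ cong (ψ ∘ inject) (psub-sub (λ _ → refl) f h q) ⟩
        ψ (inject (psub id f (psub id h q)))     ≡⟨ h-mono q ⟩
        col₀                                     ∎

    extend : ∀ col m → m ≤ count col (col₀ ∷ d) →
             ∃[ h ] ((p : Prefix t m) → ψ (psub id h p) ≡ col)
    extend col m m≤ with col Fin.≟ col₀
    extend col m       m≤       | no  _    = extendLetter col m m≤
    extend col zero    m≤       | yes refl = extendLetter col zero z≤n
    extend col (suc m) (s≤s m≤) | yes refl = extendNew m m≤

sucs : ∀ {c} → List (Fin (suc c)) → List (Fin c)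
sucs []           = []
sucs (zero  ∷ is) = sucs is
sucs (suc i ∷ is) = i ∷ sucs is

count-suc : ∀ {c} (i : Fin c) is → count (suc i) is ≡ count i (sucs is)
count-suc i []           = refl
count-suc i (zero ∷ is)  = count-suc i is
count-suc i (suc j ∷ is) with i Fin.≟ j
... | yes refl = cong suc (count-suc i is)
... | no _     = count-suc i is

length-sucs : ∀ {c} (is : List (Fin (suc c))) →
              List.length is ≡ count zero is + List.length (sucs is)
length-sucs []           = refl
length-sucs (zero ∷ is)  = cong suc (length-sucs is)
length-sucs (suc i ∷ is) = trans (cong suc (length-sucs is)) (sym (ℕ.+-suc _ _))

frequent : ∀ c m (is : List (Fin c)) → c * m < List.length is → ∃[ i ] m ≤ count i is
frequent zero    m (() ∷ _) _
frequent (suc c) m is       l with m ℕ.≤? count zero is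
... | yes m≤ = zero , m≤
... | no  m≰ =
  let i , m≤ = frequent c m (sucs is) (ℕ.+-cancelˡ-< m _ _ (ℕ.<-≤-trans l
                 (ℕ.≤-trans (ℕ.≤-reflexive (length-sucs is))
                            (ℕ.+-monoˡ-≤ _ (ℕ.<⇒≤ (ℕ.≰⇒> m≰))))))
  in suc i , subst (m ≤_) (sym (count-suc i is)) m≤

-- The colour is made to depend on the prefix alone and then on its length alone. The pigeonhole
-- principle leaves `m` lengths of one colour, and there the parameters of `h` first occur.
graham-rothschild : ∀ t k → GrahamRothschild t k
graham-rothschild t zero = hales-jewett t
graham-rothschild zero (suc k) c col zero = 0 , λ χ → [] , col , λ ()
-- Without letters a word starts with its first parameter. This case stands apart since
-- `length-coloring` fills the discarded places with a letter.
graham-rothschild zero (suc k) c col (suc m) =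
  let n , mono = graham-rothschild 1 k c col m in suc n , λ χ →
  let h , col , h-mono = mono (χ ∘ new) in
  new h , col , λ { (new g) → trans (cong χ (new-⊙-new h g)) (h-mono g) }
graham-rothschild (suc t) (suc k) c col m =
  -- With `c` colours on `suc (c * m)` lengths, some colour occurs at least `m` times.
  let n₁ , byLength = length-coloring (hales-jewett (suc t)) zero c col (suc (c * m))
      n  , byPrefix = prefix-coloring (graham-rothschild (suc (suc t)) k) c col n₁
  in n , λ χ →
  let f , ψ , f-prefix = byPrefix χ
      d , ∣d∣ , sel    = byLength ψ
      col , m≤         = frequent c m d (ℕ.≤-reflexive (sym ∣d∣))
      h , h-mono       = sel col m m≤
      open ≡-Reasoning
  in f ⊙ h , col , λ g → begin
  χ ((f ⊙ h) ⊙ g)            ≡⟨ cong χ (⊙-assoc f h g) ⟩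
  χ (f ⊙ (h ⊙ g))            ≡⟨ f-prefix (h ⊙ g) ⟩
  ψ (prefix (h ⊙ g))         ≡⟨ cong ψ (prefix-sub id h g) ⟩
  ψ (psub id h (prefix g))   ≡⟨ h-mono (prefix g) ⟩
  col                        ∎

-- Parameter words without letters are rigid surjections

eval : PWord t k n → (Fin t → X) → (Fin k → X) → Fin n → X
eval (a ∷ h) ρ θ zero    = ρ a
eval (a ∷ h) ρ θ (suc i) = eval h ρ θ i
eval (new h) ρ θ zero    = θ zero
eval (new h) ρ θ (suc i) = eval h (θ zero ◂ ρ) (θ ∘ suc) i

-- Substitution turns into composition: `θ` is pulled back along `g` and then along `h`.
eval-sub : ∀ {σ : Fin s → Fin t} {ρ : Fin t → X} {ρ′ : Fin s → X} {θ : Fin k → X} →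
           (∀ a → ρ (σ a) ≡ ρ′ a) → (h : PWord s m n) (g : PWord t k m) → ∀ i →
           eval (sub σ h g) ρ θ i ≡ eval h ρ′ (eval g ρ θ) i
eval-sub eq []      []      ()
eval-sub eq (a ∷ h) g       zero    = eq a
eval-sub eq (a ∷ h) g       (suc i) = eval-sub eq h g i
eval-sub eq (new h) (b ∷ g) zero    = refl
eval-sub eq (new h) (b ∷ g) (suc i) =
  eval-sub (λ { zero → refl ; (suc a) → eq a }) h g i
eval-sub eq (new h) (new g) zero    = refl
eval-sub eq (new h) (new g) (suc i) =
  eval-sub (λ { zero → refl ; (suc a) → eq a }) h g i

eval-natural : ∀ {ρ : Fin t → X} {ρ′ : Fin t → Y} {θ : Fin k → X} {θ′ : Fin k → Y} →
               (φ : X → Y) → (∀ a → φ (ρ a) ≡ ρ′ a) → (∀ j → φ (θ j) ≡ θ′ j) →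
               (h : PWord t k n) → ∀ i → φ (eval h ρ θ i) ≡ eval h ρ′ θ′ i
eval-natural φ eq eq′ (a ∷ h) zero    = eq a
eval-natural φ eq eq′ (a ∷ h) (suc i) = eval-natural φ eq eq′ h i
eval-natural φ eq eq′ (new h) zero    = eq′ zero
eval-natural φ eq eq′ (new h) (suc i) =
  eval-natural φ (λ { zero → eq′ zero ; (suc a) → eq a }) (eq′ ∘ suc) h i

eval-range : ∀ (ρ : Fin t → X) (θ : Fin k → X) (h : PWord t k n) i →
             (∃[ a ] eval h ρ θ i ≡ ρ a) ⊎ (∃[ j ] eval h ρ θ i ≡ θ j)
eval-range ρ θ (a ∷ h) zero    = inj₁ (a , refl)
eval-range ρ θ (a ∷ h) (suc i) = eval-range ρ θ h i
eval-range ρ θ (new h) zero    = inj₂ (zero , refl)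
eval-range ρ θ (new h) (suc i) with eval-range (θ zero ◂ ρ) (θ ∘ suc) h i
... | inj₁ (zero , eq)  = inj₂ (zero , eq)
... | inj₁ (suc a , eq) = inj₁ (a , eq)
... | inj₂ (j , eq)     = inj₂ (suc j , eq)

first : PWord t k n → Fin k → Fin n
first (a ∷ h) j       = suc (first h j)
first (new h) zero    = zero
first (new h) (suc j) = suc (first h j)

first-mono : (h : PWord t k n) → ∀ {i j} → i Fin.< j → first h i Fin.< first h j
first-mono (a ∷ h)                 i<j       = s≤s (first-mono h i<j)
first-mono (new h) {zero}  {suc j} _         = s≤s z≤n
first-mono (new h) {suc i} {suc j} (s≤s i<j) = s≤s (first-mono h i<j)

eval-first : ∀ (ρ : Fin t → X) θ (h : PWord t k n) j → eval h ρ θ (first h j) ≡ θ j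
eval-first ρ θ (a ∷ h) j       = eval-first ρ θ h j
eval-first ρ θ (new h) zero    = refl
eval-first ρ θ (new h) (suc j) = eval-first _ _ h j

record Distinct (ρ : Fin t → X) (θ : Fin k → X) : Set where
  field
    injective : ∀ {i j} → θ i ≡ θ j → i ≡ j
    disjoint  : ∀ {a j} → ρ a ≢ θ j

open Distinct

distinct-new : ∀ {ρ : Fin t → X} {θ : Fin (suc k) → X} →
               Distinct ρ θ → Distinct (θ zero ◂ ρ) (θ ∘ suc)
distinct-new D .injective eq = Fin.suc-injective (D .injective eq)
distinct-new D .disjoint {zero}  eq with () ← D .injective eq
distinct-new D .disjoint {suc a} eq = D .disjoint eq

first-least : ∀ {ρ : Fin t → X} {θ} → Distinct ρ θ → (h : PWord t k n) → ∀ {i j} →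
              eval h ρ θ i ≡ θ j → first h j Fin.≤ i
first-least D (a ∷ h) {zero}  {j}     eq = contradiction eq (D .disjoint)
first-least D (a ∷ h) {suc i} {j}     eq = s≤s (first-least D h eq)
first-least D (new h) {i}     {zero}  eq = z≤n
first-least D (new h) {zero}  {suc j} eq with () ← D .injective eq
first-least D (new h) {suc i} {suc j} eq = s≤s (first-least (distinct-new D) h eq)

-- `ordered` speaks of every occurrence instead of comparing minima, a form that passes to
-- `F ∘ suc`; a value already met moves from `θ` to `ρ`.
record Rigid (ρ : Fin t → X) (θ : Fin k → X) (F : Fin n → X) : Set where
  field
    covered : ∀ i → (∃[ a ] F i ≡ ρ a) ⊎ (∃[ j ] F i ≡ θ j)
    onto    : ∀ j → ∃[ i ] F i ≡ θ j
    ordered : ∀ {i j j′} → F i ≡ θ j → j′ Fin.< j → ∃[ i′ ] (i′ Fin.< i × F i′ ≡ θ j′)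

open Rigid

rigid-word : ∀ {ρ : Fin t → X} {θ : Fin k → X} (F : Fin n → X) → Distinct ρ θ →
             Rigid ρ θ F → ∃[ h ] (∀ i → eval {n = n} h ρ θ i ≡ F i)
rigid-word {k = zero}  {n = zero} F D R = [] , λ ()
rigid-word {k = suc k} {n = zero} F D R with () ← R .onto zero .proj₁
rigid-word {n = suc n} {ρ} {θ} F D R with R .covered zero
... | inj₁ (a , F0) =
  let h , eq = rigid-word (F ∘ suc) D R′ in
  a ∷ h , λ { zero → sym F0 ; (suc i) → eq i }
  where
  R′ : Rigid ρ θ (F ∘ suc)
  R′ .covered i = R .covered (suc i)
  R′ .onto j with R .onto j
  ... | zero  , eq = contradiction (trans (sym F0) eq) (D .disjoint)
  ... | suc i , eq = i , eq
  R′ .ordered eq j′<j with R .ordered eq j′<j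
  ... | zero   , _      , eq′ = contradiction (trans (sym F0) eq′) (D .disjoint)
  ... | suc i′ , s≤s lt , eq′ = i′ , lt , eq′
-- New values are met in their order, so a new value in the first place can only be `θ zero`.
... | inj₂ (suc j , F0) with R .ordered F0 (s≤s z≤n)
...   | _ , () , _
rigid-word {k = suc k} {n = suc n} {ρ} {θ} F D R | inj₂ (zero , F0) =
  let h , eq = rigid-word (F ∘ suc) (distinct-new D) R′ in
  new h , λ { zero → sym F0 ; (suc i) → eq i }
  where
  R′ : Rigid (θ zero ◂ ρ) (θ ∘ suc) (F ∘ suc)
  R′ .covered i with R .covered (suc i)
  ... | inj₁ (a , eq)     = inj₁ (suc a , eq)
  ... | inj₂ (zero , eq)  = inj₁ (zero , eq)
  ... | inj₂ (suc j , eq) = inj₂ (j , eq)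
  R′ .onto j with R .onto (suc j)
  ... | zero  , eq with () ← D .injective (trans (sym F0) eq)
  ... | suc i , eq = i , eq
  R′ .ordered eq j′<j with R .ordered eq (s≤s j′<j)
  ... | zero   , _      , eq′ with () ← D .injective (trans (sym F0) eq′)
  ... | suc i′ , s≤s lt , eq′ = i′ , lt , eq′

-- Increasing enumerations

record Enumeration (_≺_ : Rel X 0ℓ) (P : Pred X 0ℓ) : Set where
  field
    size     : ℕ
    at       : Fin size → X
    mono     : ∀ {i j} → i Fin.< j → at i ≺ at j
    sound    : ∀ i → P (at i)
    complete : ∀ {x} → P x → ∃[ i ] at i ≡ x

module _ {_≺_ : Rel X 0ℓ} (sto : IsStrictTotalOrder _≡_ _≺_) where
  private module O = IsStrictTotalOrder sto

  -- Duplicates are dropped, so that the sorted list is strictly increasing.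
  insert : X → List X → List X
  insert x []       = x ∷ []
  insert x (y ∷ ys) with O.compare x y
  ... | tri< _ _ _ = x ∷ y ∷ ys
  ... | tri≈ _ _ _ = y ∷ ys
  ... | tri> _ _ _ = y ∷ insert x ys

  insert-All : ∀ {P : Pred X 0ℓ} {x ys} → P x → All P ys → All P (insert x ys)
  insert-All px [] = px ∷ []
  insert-All {x = x} {y ∷ ys} px (py ∷ pys) with O.compare x y
  ... | tri< _ _ _ = px ∷ py ∷ pys
  ... | tri≈ _ _ _ = py ∷ pys
  ... | tri> _ _ _ = py ∷ insert-All px pys

  insert-sorted : ∀ {x ys} → AllPairs _≺_ ys → AllPairs _≺_ (insert x ys)
  insert-sorted [] = [] ∷ []
  insert-sorted {x} {y ∷ ys} (y≺ ∷ s) with O.compare x y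
  ... | tri< x≺y _ _ = (x≺y ∷ All.map (O.trans x≺y) y≺) ∷ y≺ ∷ s
  ... | tri≈ _ _ _   = y≺ ∷ s
  ... | tri> _ _ y≺x = insert-All y≺x y≺ ∷ insert-sorted s

  ∈-insert-new : ∀ x ys → x ∈ˡ insert x ys
  ∈-insert-new x []       = here refl
  ∈-insert-new x (y ∷ ys) with O.compare x y
  ... | tri< _ _ _    = here refl
  ... | tri≈ _ refl _ = here refl
  ... | tri> _ _ _    = there (∈-insert-new x ys)

  ∈-insert-old : ∀ x ys {z} → z ∈ˡ ys → z ∈ˡ insert x ys
  ∈-insert-old x (y ∷ ys) z∈ with O.compare x y
  ∈-insert-old x (y ∷ ys) z∈         | tri< _ _ _ = there z∈
  ∈-insert-old x (y ∷ ys) z∈         | tri≈ _ _ _ = z∈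
  ∈-insert-old x (y ∷ ys) (here eq)  | tri> _ _ _ = here eq
  ∈-insert-old x (y ∷ ys) (there z∈) | tri> _ _ _ = there (∈-insert-old x ys z∈)

  sort : (xs : List X) → ∃[ ys ] (AllPairs _≺_ ys ×
         (∀ {P : Pred X 0ℓ} → All P xs → All P ys) × (∀ {x} → x ∈ˡ xs → x ∈ˡ ys))
  sort []       = [] , [] , id , id
  sort (x ∷ xs) =
    let ys , sorted , all , sub = sort xs in
    insert x ys , insert-sorted sorted , (λ { (p ∷ ps) → insert-All p (all ps) }) ,
    λ { (here refl) → ∈-insert-new _ ys ; (there x∈) → ∈-insert-old x ys (sub x∈) }

  lookup-mono : ∀ {xs} → AllPairs _≺_ xs → ∀ {i j} → i Fin.< j →
                List.lookup xs i ≺ List.lookup xs j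
  lookup-mono (x≺ ∷ s) {zero}  {suc j} _         = All.lookup x≺ (∈-lookup j)
  lookup-mono (x≺ ∷ s) {suc i} {suc j} (s≤s i<j) = lookup-mono s i<j

  enumerate : ∀ {P : Pred X 0ℓ} → Decidable P → (xs : List X) → (∀ x → x ∈ˡ xs) →
              Enumeration _≺_ P
  enumerate P? xs all =
    let ys , sorted , sound , complete = sort (List.filter P? xs) in record
    { size     = List.length ys
    ; at       = List.lookup ys
    ; mono     = lookup-mono sorted
    ; sound    = λ i → All.lookup (sound (all-filter P? xs)) (∈-lookup i)
    ; complete = λ {x} Px → let x∈ = complete (∈-filter⁺ P? (all x) Px) in
                            Any.index x∈ , sym (lookup-index x∈)
    }

  module _ {f : Fin n → X} (mono : ∀ {i j} → i Fin.< j → f i ≺ f j) where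
    mono-injective : ∀ {i j} → f i ≡ f j → i ≡ j
    mono-injective {i} {j} eq with Fin.<-cmp i j
    ... | tri< i<j _ _ = ⊥-elim (O.irrefl eq (mono i<j))
    ... | tri≈ _ i≡j _ = i≡j
    ... | tri> _ _ j<i = ⊥-elim (O.irrefl (sym eq) (mono j<i))

    mono-reflects : ∀ {i j} → f i ≺ f j → i Fin.< j
    mono-reflects {i} {j} lt with Fin.<-cmp i j
    ... | tri< i<j _ _  = i<j
    ... | tri≈ _ refl _ = ⊥-elim (O.irrefl refl lt)
    ... | tri> _ _ j<i  = ⊥-elim (O.asym lt (mono j<i))

    mono-≤ : ∀ {i j} → i Fin.≤ j → f i ≺ f j ⊎ f i ≡ f j
    mono-≤ {i} {j} i≤j with Fin.<-cmp i j
    ... | tri< i<j _ _  = inj₁ (mono i<j)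
    ... | tri≈ _ refl _ = inj₂ refl
    ... | tri> _ _ j<i  = ⊥-elim (ℕ.<⇒≱ j<i i≤j)

increasing⇒≤ : (σ : Fin m → Fin n) → (∀ {i j} → i Fin.< j → σ i Fin.< σ j) → ∀ i → i Fin.≤ σ i
increasing⇒≤ σ σ-mono zero = z≤n
increasing⇒≤ σ σ-mono (suc i) =
  ℕ.≤-<-trans
    (increasing⇒≤ (σ ∘ Fin.inject₁)
      (λ {i} {j} → σ-mono ∘ subst₂ _<_ (sym (Fin.toℕ-inject₁ i)) (sym (Fin.toℕ-inject₁ j))) i)
    (σ-mono (s≤s (ℕ.≤-reflexive (Fin.toℕ-inject₁ i))))

subsets : ∀ n → List (Subset n)
subsets zero    = [] ∷ []
subsets (suc n) = List.map (inside ∷_) (subsets n) List.++ List.map (outside ∷_) (subsets n)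

∈-subsets : (p : Subset n) → p ∈ˡ subsets n
∈-subsets []            = here refl
∈-subsets (inside ∷ p)  = ∈-++⁺ˡ (∈-map⁺ _ (∈-subsets p))
∈-subsets (outside ∷ p) = ∈-++⁺ʳ _ (∈-map⁺ _ (∈-subsets p))

-- Edges as increasing sequences of vertices

open SetOrderProperties (Fin.<-isStrictTotalOrder {0}) using (∣p∣≡1⇒p≡⁅x⁆)

∣e∣≡1⇒≡ : ∀ {e : Subset n} → ∣ e ∣ ≡ 1 → ∀ {x y} → x ∈ e → y ∈ e → x ≡ y
∣e∣≡1⇒≡ {e = e} eq x∈ y∈ with ∣p∣≡1⇒p≡⁅x⁆ e eq
... | z , refl = trans (x∈⁅y⁆⇒x≡y z x∈) (sym (x∈⁅y⁆⇒x≡y z y∈))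

≡⇒∣e∣≡1 : ∀ {e : Subset n} {x} → x ∈ e → (∀ {y} → y ∈ e → y ≡ x) → ∣ e ∣ ≡ 1
≡⇒∣e∣≡1 {x = x} x∈ all = trans (cong ∣_∣ (⊆-antisym
  (λ y∈ → subst (_∈ ⁅ x ⁆) (sym (all y∈)) (x∈⁅x⁆ x))
  (λ y∈ → subst (_∈ _) (sym (x∈⁅y⁆⇒x≡y x y∈)) x∈))) (∣⁅x⁆∣≡1 x)

image-∣∣≡1 : ∀ (f : Fin m → Fin n) {e} → ∣ e ∣ ≡ 1 → ∣ image f e ∣ ≡ 1
image-∣∣≡1 f {e} eq with ∣p∣≡1⇒p≡⁅x⁆ e eq
... | x , refl = ≡⇒∣e∣≡1 (∈-image⁺ f ⁅ x ⁆ (x∈⁅x⁆ x)) λ y∈ →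
  let z , z∈ , fz≡y = ∈-image⁻ f ⁅ x ⁆ y∈ in
  trans (sym fz≡y) (cong f (x∈⁅y⁆⇒x≡y x z∈))

module _ {_≺_ : Rel (Fin n) 0ℓ} (sto : IsStrictTotalOrder _≡_ _≺_) where
  enumerateSubset : (e : Subset n) → Enumeration _≺_ (_∈ e)
  enumerateSubset e = enumerate sto (_∈? e) (List.allFin n) ∈-allFin

  size≡∣∣ : ∀ {e} (enum : Enumeration _≺_ (_∈ e)) → Enumeration.size enum ≡ ∣ e ∣
  size≡∣∣ {e} enum = trans (sym (∣image⊤∣ at (mono-injective sto mono))) (cong ∣_∣ (⊆-antisym
    (λ x∈ → let i , _ , eq = ∈-image⁻ at Subset.⊤ x∈ in subst (_∈ e) eq (sound i))
    (λ x∈ → let i , eq = complete x∈ in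
            subst (_∈ image at Subset.⊤) eq (∈-image⁺ at Subset.⊤ ∈⊤))))
    where open Enumeration enum

module _ (G : OrderedHypergraph r) where
  open OrderedHypergraph G
  private module O = IsStrictTotalOrder isStrictTotalOrder

  abstract
    edgeEnumeration : Enumeration _⊏sal_ E
    edgeEnumeration = enumerate sal-isStrictTotalOrder
      (λ e → (∣ e ∣ ℕ.≟ 1) ⊎-dec S? e) (subsets order) ∈-subsets

  -- A singleton is listed r times.
  record Listing (e : Subset order) (p : Fin r → Fin order) : Set where
    field
      member     : ∀ i → p i ∈ e
      onto       : ∀ {x} → x ∈ e → ∃[ i ] p i ≡ x
      increasing : ∣ e ∣ ≢ 1 → ∀ {i j} → i Fin.< j → p i ⊏ p j

  open Listing

  image-listing : ∀ {e p} → Listing e p → image p Subset.⊤ ≡ e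
  image-listing {e} {p} P = ⊆-antisym
    (λ x∈ → let i , _ , eq = ∈-image⁻ p Subset.⊤ x∈ in subst (_∈ e) eq (P .member i))
    (λ x∈ → let i , eq = P .onto x∈ in subst (_∈ image p Subset.⊤) eq (∈-image⁺ p Subset.⊤ ∈⊤))

  abstract
    listing : 2 ≤ r → ∀ {e} → E e → ∃[ p ] Listing e p
    listing (s≤s _) {e} (inj₁ ∣e∣≡1) with ∣p∣≡1⇒p≡⁅x⁆ e ∣e∣≡1
    ... | x , refl = const x , record
      { member     = λ _ → x∈⁅x⁆ x
      ; onto       = λ y∈ → zero , sym (x∈⁅y⁆⇒x≡y x y∈)
      ; increasing = contradiction ∣e∣≡1
      }
    listing _ {e} (inj₂ Se) = fromEnumeration enum
        (trans (size≡∣∣ isStrictTotalOrder enum) (uniform Se))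
      where
      enum : Enumeration _⊏_ (_∈ e)
      enum = enumerateSubset isStrictTotalOrder e
      fromEnumeration : (en : Enumeration _⊏_ (_∈ e)) → Enumeration.size en ≡ r →
                        ∃[ p ] Listing e p
      fromEnumeration en refl = at , record
        { member     = sound
        ; onto       = complete
        ; increasing = λ _ → mono
        }
        where open Enumeration en

  -- q i = p (τ i) for an increasing τ, and increasing maps Fin r → Fin r are
  -- inflationary.
  listing-≤ : ∀ {e p q} → Listing e p → Listing e q → ∣ e ∣ ≢ 1 → ∀ i → p i ⊏ q i ⊎ p i ≡ q i
  listing-≤ {p = p} {q} P Q ≢1 i =
    subst (λ x → p i ⊏ x ⊎ p i ≡ x) (p-τ i)
      (mono-≤ isStrictTotalOrder (P .increasing ≢1) (increasing⇒≤ τ τ-mono i))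
    where
    τ : Fin r → Fin r
    τ i = P .onto (Q .member i) .proj₁
    p-τ : ∀ i → p (τ i) ≡ q i
    p-τ i = P .onto (Q .member i) .proj₂
    τ-mono : ∀ {i j} → i Fin.< j → τ i Fin.< τ j
    τ-mono {i} {j} i<j = mono-reflects isStrictTotalOrder (P .increasing ≢1)
      (subst₂ _⊏_ (sym (p-τ i)) (sym (p-τ j)) (Q .increasing ≢1 i<j))

  -- This is why the image of a column determines a quotient map on that column.
  listing-unique : ∀ {e p q} → Listing e p → Listing e q → ∀ i → p i ≡ q i
  listing-unique {e} {p} {q} P Q i with ∣ e ∣ ℕ.≟ 1
  ... | yes ≡1 = ∣e∣≡1⇒≡ ≡1 (P .member i) (Q .member i)
  ... | no  ≢1 with listing-≤ P Q ≢1 i | listing-≤ Q P ≢1 i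
  ...   | inj₂ eq | _       = eq
  ...   | inj₁ _  | inj₂ eq = sym eq
  ...   | inj₁ lt | inj₁ gt = ⊥-elim (O.asym lt gt)

  1<∣edge∣ : 2 ≤ r → ∀ {e} → E e → ∣ e ∣ ≢ 1 → 1 < ∣ e ∣
  1<∣edge∣ r≥2 (inj₁ ≡1) ≢1 = contradiction ≡1 ≢1
  1<∣edge∣ r≥2 (inj₂ Se) _  = subst (1 <_) (sym (uniform Se)) r≥2

  singleton-least : ∀ {X Y v} → ∣ Y ∣ ≡ 1 → v ∈ Y → v ∈ X → ¬ (X ⊏sal Y)
  singleton-least ≡1 v∈Y v∈X (empty-least refl _) = ∉⊥ v∈X
  singleton-least ≡1 v∈Y v∈X (singletons {x} {y} refl refl x⊏y) =
    O.irrefl (trans (sym (x∈⁅y⁆⇒x≡y x v∈X)) (x∈⁅y⁆⇒x≡y y v∈Y)) x⊏y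
  singleton-least ≡1 v∈Y v∈X (one-many _ 1<)      = ℕ.<-irrefl (sym ≡1) 1<
  singleton-least ≡1 v∈Y v∈X (many-many _ 1< _)   = ℕ.<-irrefl (sym ≡1) 1<

-- If the image has more than one vertex, then `map` is not constant on `e`, and `strong` preserves
-- the order of the listing.
listing-map : ∀ (G H : OrderedHypergraph r) (f : StrongRigidQuotientMap G H) →
              let open StrongRigidQuotientMap f in
              ∀ {e p} → OrderedHypergraph.E G e → Listing G e p → Listing H (image map e) (map ∘ p)
listing-map G H f {e} {p} Ee P = record
  { member     = λ i → ∈-image⁺ map e (P .member i)
  ; onto       = λ y∈ → let x , x∈ , fx≡y = ∈-image⁻ map e y∈
                            i , pi≡x = P .onto x∈
                        in i , trans (cong map pi≡x) fx≡y
  ; increasing = λ ≢1 {i} {j} i<j → strong Ee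
      (λ const → ≢1 (≡⇒∣e∣≡1 (∈-image⁺ map e (P .member i)) λ y∈ →
        let x , x∈ , fx≡y = ∈-image⁻ map e y∈ in
        trans (sym fx≡y) (const x∈ (P .member i))))
      (P .member i) (P .member j) (P .increasing (≢1 ∘ image-∣∣≡1 map) i<j)
  }
  where
  open StrongRigidQuotientMap f
  open Listing

-- Quotient maps from r ⊠ n

natural : ℕ → FiniteChain
natural n = record { size = n ; _⊏_ = Fin._<_ ; isStrictTotalOrder = Fin.<-isStrictTotalOrder }

least : 2 ≤ r → Σ (Fin r) λ z → ∀ (i : Fin r) → z Fin.≤ i
least (s≤s _) = zero , λ _ → z≤n

greatest : 2 ≤ r → Σ (Fin r) λ z → ∀ (i : Fin r) → i Fin.≤ z
greatest (s≤s {n = r′} _) = Fin.fromℕ r′ , Fin.≤fromℕ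

module _ (r n : ℕ) where
  private
    G = r ⊠ natural n
    module G = OrderedHypergraph G

    Lex : Rel (Fin r × Fin n) 0ℓ
    Lex (i , ℓ) (i′ , ℓ′) = ℓ Fin.< ℓ′ ⊎ (ℓ ≡ ℓ′ × i Fin.< i′)

  ≺-combine⁺ : ∀ {i i′ ℓ ℓ′} → Lex (i , ℓ) (i′ , ℓ′) → combine i ℓ G.⊏ combine i′ ℓ′
  ≺-combine⁺ {i} {i′} {ℓ} {ℓ′} =
    subst₂ Lex (sym (Fin.remQuot-combine i ℓ)) (sym (Fin.remQuot-combine i′ ℓ′))

  ≺-combine⁻ : ∀ {i i′ ℓ ℓ′} → combine i ℓ G.⊏ combine i′ ℓ′ → Lex (i , ℓ) (i′ , ℓ′)
  ≺-combine⁻ {i} {i′} {ℓ} {ℓ′} =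
    subst₂ Lex (Fin.remQuot-combine i ℓ) (Fin.remQuot-combine i′ ℓ′)

  ∈-column⁺ : ∀ i ℓ → combine i ℓ ∈ column r (natural n) ℓ
  ∈-column⁺ i ℓ = ∈-image⁺ (λ (i : Fin r) → combine i ℓ) Subset.⊤ (∈⊤ {x = i})

  ∈-column⁻ : ∀ ℓ {u} → u ∈ column r (natural n) ℓ → ∃[ i ] combine {r} i ℓ ≡ u
  ∈-column⁻ ℓ u∈ = let i , _ , eq = ∈-image⁻ (λ (i : Fin r) → combine i ℓ) Subset.⊤ u∈ in i , eq

  1<∣column∣ : 2 ≤ r → ∀ ℓ → 1 < ∣ column r (natural n) ℓ ∣
  1<∣column∣ r≥2 ℓ = subst (1 <_) (sym (∣column∣ r (natural n) ℓ)) r≥2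

  -- The top vertex of the later column lies above all other vertices of both columns, so it decides
  -- the comparison.
  column-mono : 2 ≤ r → ∀ {ℓ ℓ′} → ℓ Fin.< ℓ′ → column r (natural n) ℓ G.⊏sal column r (natural n) ℓ′
  column-mono r≥2 {ℓ} {ℓ′} ℓ<ℓ′ = G.many-many (1<∣column∣ r≥2 ℓ) (1<∣column∣ r≥2 ℓ′)
    (SetOrderProperties.colex⇒alex G.isStrictTotalOrder
      {column r (natural n) ℓ} {column r (natural n) ℓ′}
      (combine top ℓ′ , ∈-column⁺ top ℓ′ , top∉ , λ x above →
        (λ x∈ → ⊥-elim (above-ℓ x∈ above)) , λ x∈ → ⊥-elim (above-ℓ′ x∈ above)))
    where
    top = proj₁ (greatest r≥2)
    top∉ : ¬ (combine top ℓ′ ∈ column r (natural n) ℓ)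
    top∉ ∈ℓ = let i , eq = ∈-column⁻ ℓ ∈ℓ in
              Fin.<-irrefl (Fin.combine-injectiveʳ i ℓ top ℓ′ eq) ℓ<ℓ′
    above-ℓ : ∀ {x} → x ∈ column r (natural n) ℓ → ¬ (combine top ℓ′ G.⊏ x)
    above-ℓ x∈ lt with ∈-column⁻ ℓ x∈
    ... | i , refl with ≺-combine⁻ {top} {i} {ℓ′} {ℓ} lt
    ...   | inj₁ ℓ′<ℓ       = Fin.<-asym ℓ<ℓ′ ℓ′<ℓ
    ...   | inj₂ (refl , _) = Fin.<-irrefl refl ℓ<ℓ′
    above-ℓ′ : ∀ {x} → x ∈ column r (natural n) ℓ′ → ¬ (combine top ℓ′ G.⊏ x)
    above-ℓ′ x∈ lt with ∈-column⁻ ℓ′ x∈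
    ... | i , refl with ≺-combine⁻ {top} {i} {ℓ′} {ℓ′} lt
    ...   | inj₁ ℓ<ℓ         = Fin.<-irrefl refl ℓ<ℓ
    ...   | inj₂ (_ , top<i) = ℕ.<⇒≱ top<i (proj₂ (greatest r≥2) i)

none : {X : Set} → Fin 0 → X
none ()

module _ {r} (A : OrderedHypergraph r) where
  private
    module A = OrderedHypergraph A
    module sal = IsStrictTotalOrder A.sal-isStrictTotalOrder
  open Enumeration (edgeEnumeration A)

  edgeAt : PWord 0 size n → Fin n → Subset A.order
  edgeAt h = eval h none at

  at-distinct : Distinct none at
  at-distinct = record { injective = mono-injective A.sal-isStrictTotalOrder mono
                       ; disjoint  = λ { {()} } }

  edgeAt-index : (h : PWord 0 size n) → ∀ ℓ → ∃[ j ] edgeAt h ℓ ≡ at j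
  edgeAt-index h ℓ with eval-range none at h ℓ
  ... | inj₂ j = j

  edgeAt∈E : (h : PWord 0 size n) → ∀ ℓ → A.E (edgeAt h ℓ)
  edgeAt∈E h ℓ = let j , eq = edgeAt-index h ℓ in subst A.E (sym eq) (sound j)

  module _ (r≥2 : 2 ≤ r) {n} (h : PWord 0 size n) where
    private
      G = r ⊠ natural n
      module G = OrderedHypergraph G

    vertex : Fin (r * n) → Fin A.order
    vertex u = let i , ℓ = remQuot n u in proj₁ (listing A r≥2 (edgeAt∈E h ℓ)) i

    vertex-listing : ∀ ℓ → Listing A (edgeAt h ℓ) (λ i → vertex (combine i ℓ))
    vertex-listing ℓ = record
      { member     = λ i → subst (_∈ edgeAt h ℓ) (sym (eq i)) (P .member i)
      ; onto       = λ x∈ → let i , pi≡x = P .onto x∈ in i , trans (eq i) pi≡x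
      ; increasing = λ ≢1 {i} {j} i<j →
          subst₂ A._⊏_ (sym (eq i)) (sym (eq j)) (P .increasing ≢1 i<j)
      }
      where
      open Listing
      P = proj₂ (listing A r≥2 (edgeAt∈E h ℓ))
      eq : ∀ i → vertex (combine i ℓ) ≡ proj₁ (listing A r≥2 (edgeAt∈E h ℓ)) i
      eq i = cong (λ (i , ℓ) → proj₁ (listing A r≥2 (edgeAt∈E h ℓ)) i) (Fin.remQuot-combine {r} i ℓ)

    image-column : ∀ ℓ → image vertex (column r (natural n) ℓ) ≡ edgeAt h ℓ
    image-column ℓ = trans (sym (image-∘ vertex (λ (i : Fin r) → combine i ℓ) Subset.⊤))
                           (image-listing A (vertex-listing ℓ))

    vertex-hom : IsHomomorphism G A vertex
    vertex-hom (inj₁ ≡1)         = inj₁ (image-∣∣≡1 vertex ≡1)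
    vertex-hom (inj₂ (ℓ , refl)) = subst A.E (sym (image-column ℓ)) (edgeAt∈E h ℓ)

    first≤ : ∀ {j ℓ} → edgeAt h ℓ ≡ at j → first h j Fin.≤ ℓ
    first≤ = first-least at-distinct h

    -- The least preimage of the edge `at j`. The decision is an argument so that the lemmas below
    -- can split on it for two indices independently.
    minEdge : ∀ j → Dec (∣ at j ∣ ≡ 1) → Subset (r * n)
    minEdge j (yes _) = ⁅ combine (proj₁ (least r≥2)) (first h j) ⁆
    minEdge j (no _)  = column r (natural n) (first h j)

    minEdge∈E : ∀ j d → G.E (minEdge j d)
    minEdge∈E j (yes _) = inj₁ (∣⁅x⁆∣≡1 (combine (proj₁ (least r≥2)) (first h j)))
    minEdge∈E j (no _)  = inj₂ (first h j , refl)

    minEdge-image : ∀ j d → image vertex (minEdge j d) ≡ at j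
    minEdge-image j (no _)   = trans (image-column (first h j)) (eval-first none at h j)
    minEdge-image j (yes ≡1) = ⊆-antisym
      (λ y∈ → let u , u∈ , eq = ∈-image⁻ vertex ⁅ z ⁆ y∈ in
              subst (_∈ at j) (trans (cong vertex (sym (x∈⁅y⁆⇒x≡y z u∈))) eq) vz∈)
      (λ y∈ → subst (_∈ image vertex ⁅ z ⁆) (∣e∣≡1⇒≡ ≡1 vz∈ y∈)
                    (∈-image⁺ vertex ⁅ z ⁆ (x∈⁅x⁆ z)))
      where
      z = combine (proj₁ (least r≥2)) (first h j)
      vz∈ : vertex z ∈ at j
      vz∈ = subst (vertex z ∈_) (eval-first none at h j)
                  (Listing.member (vertex-listing (first h j)) _)

    minEdge-mono : ∀ {i j} d d′ → i Fin.< j → minEdge i d G.⊏sal minEdge j d′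
    minEdge-mono {i} {j} (yes _) (yes _) i<j =
      G.singletons refl refl (≺-combine⁺ r n (inj₁ (first-mono h i<j)))
    minEdge-mono {i} {j} (yes ≡1) (no _) i<j =
      G.one-many (∣⁅x⁆∣≡1 (combine (proj₁ (least r≥2)) (first h i))) (1<∣column∣ r n r≥2 (first h j))
    minEdge-mono {i} {j} (no ≢1) (yes ≡1) i<j = ⊥-elim (sal.asym (mono i<j)
      (A.one-many ≡1 (1<∣edge∣ A r≥2 (sound i) ≢1)))
    minEdge-mono (no _) (no _) i<j = column-mono r n r≥2 (first-mono h i<j)

    minEdge-least : ∀ j d {e} → G.E e → image vertex e ≡ at j →
                    minEdge j d G.⊏sal e ⊎ minEdge j d ≡ e
    minEdge-least j (no ≢1) (inj₁ ≡1) eq =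
      contradiction (subst (λ e → ∣ e ∣ ≡ 1) eq (image-∣∣≡1 vertex ≡1)) ≢1
    minEdge-least j (no ≢1) (inj₂ (ℓ , refl)) eq
      with Fin.<-cmp (first h j) ℓ
    ... | tri< lt _ _  = inj₁ (column-mono r n r≥2 lt)
    ... | tri≈ _ f≡ℓ _ = inj₂ (cong (column r (natural n)) f≡ℓ)
    ... | tri> _ _ gt  = ⊥-elim (ℕ.<⇒≱ gt (first≤ (trans (sym (image-column ℓ)) eq)))
    minEdge-least j (yes _) (inj₂ (ℓ , refl)) eq = inj₁ (G.one-many
      (∣⁅x⁆∣≡1 (combine (proj₁ (least r≥2)) (first h j))) (1<∣column∣ r n r≥2 ℓ))
    minEdge-least j (yes ≡1) {e} (inj₁ e≡1) eq =
      compare (∣p∣≡1⇒p≡⁅x⁆ e e≡1)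
      where
      z = proj₁ (least r≥2)
      compare : ∃[ u ] e ≡ ⁅ u ⁆ →
                ⁅ combine z (first h j) ⁆ G.⊏sal e ⊎ ⁅ combine z (first h j) ⁆ ≡ e
      compare (u , refl) with Fin.combine-surjective {r} u
      ... | i , ℓ , refl = decide (Fin.<-cmp (first h j) ℓ) (Fin.<-cmp z i)
        where
        v∈ℓ : vertex (combine i ℓ) ∈ edgeAt h ℓ
        v∈ℓ = Listing.member (vertex-listing ℓ) i
        v∈j : vertex (combine i ℓ) ∈ at j
        v∈j = subst (vertex (combine i ℓ) ∈_) eq (∈-image⁺ vertex ⁅ combine i ℓ ⁆ (x∈⁅x⁆ (combine i ℓ)))
        -- The column `ℓ` itself may go to a larger edge `at j′` that contains the vertex of the
        -- loop `at j`. That loop is the first edge containing the vertex, so `j` is at most `j′`,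
        -- and first occurrences respect this order.
        first≤ℓ : first h j Fin.≤ ℓ
        first≤ℓ with edgeAt-index h ℓ
        ... | j′ , eq′ with Fin.<-cmp j j′
        ...   | tri< j<j′ _ _ = ℕ.≤-trans (ℕ.<⇒≤ (first-mono h j<j′)) (first≤ eq′)
        ...   | tri≈ _ refl _ = first≤ eq′
        ...   | tri> _ _ j′<j = ⊥-elim (singleton-least A ≡1 v∈j
                                  (subst (vertex (combine i ℓ) ∈_) eq′ v∈ℓ) (mono j′<j))
        decide : _ → _ → ⁅ combine z (first h j) ⁆ G.⊏sal ⁅ combine i ℓ ⁆ ⊎
                 ⁅ combine z (first h j) ⁆ ≡ ⁅ combine i ℓ ⁆
        decide (tri< lt _ _)   _               = inj₁ (G.singletons refl refl (≺-combine⁺ r n (inj₁ lt)))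
        decide (tri> _ _ gt)   _               = ⊥-elim (ℕ.<⇒≱ gt first≤ℓ)
        decide (tri≈ _ eq′ _)  (tri< z<i _ _)  =
          inj₁ (G.singletons refl refl (≺-combine⁺ r n (inj₂ (eq′ , z<i))))
        decide (tri≈ _ eq′ _)  (tri≈ _ refl _) = inj₂ (cong (λ ℓ → ⁅ combine z ℓ ⁆) eq′)
        decide (tri≈ _ _ _)    (tri> _ _ i<z)  = ⊥-elim (ℕ.<⇒≱ i<z (proj₂ (least r≥2) i))

    private
      single? : ∀ j → Dec (∣ at j ∣ ≡ 1)
      single? j = ∣ at j ∣ ℕ.≟ 1

      isMin : ∀ {y} (y∈E : A.E y) {j} → at j ≡ y →
              IsMinPreimage G.edges A.edges (edgeMap G A vertex vertex-hom) (y , y∈E)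
                            (minEdge j (single? j) , minEdge∈E j (single? j))
      isMin y∈E {j} refl = minEdge-image j (single? j) ,
        λ (e , e∈E) eq → minEdge-least j (single? j) e∈E eq

    quotientMap : StrongRigidQuotientMap G A
    quotientMap = record
      { map    = vertex
      ; hom    = vertex-hom
      ; rigid  = record
        { isSurjection = record
          { isCongruent = record
            { cong           = cong (image vertex)
            ; isEquivalence₁ = StrictTotalOrder.isEquivalence G.edges
            ; isEquivalence₂ = StrictTotalOrder.isEquivalence A.edges
            }
          ; surjective  = λ (y , y∈E) →
              let j , eq = complete y∈E in
              (minEdge j (single? j) , minEdge∈E j (single? j)) ,
              λ x≈ → trans (cong (image vertex) x≈) (trans (minEdge-image j (single? j)) eq)
          }
        ; rigid = λ {(y , y∈E)} {(y′ , y′∈E)} y<y′ →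
            let j  , eq  = complete y∈E
                j′ , eq′ = complete y′∈E
            in (minEdge j (single? j) , minEdge∈E j (single? j)) ,
               (minEdge j′ (single? j′) , minEdge∈E j′ (single? j′)) ,
               isMin y∈E eq , isMin y′∈E eq′ ,
               minEdge-mono (single? j) (single? j′)
                 (mono-reflects A.sal-isStrictTotalOrder mono
                   (subst₂ A._⊏sal_ (sym eq) (sym eq′) y<y′))
        }
      ; strong = strong
      }
      where
      strong : ∀ {e} → G.E e → ¬ ConstantOn G A e vertex →
               ∀ {x y} → x ∈ e → y ∈ e → x G.⊏ y → vertex x A.⊏ vertex y
      strong (inj₁ ≡1) ¬const x∈ y∈ _ =
        ⊥-elim (¬const λ x∈ y∈ → cong vertex (∣e∣≡1⇒≡ ≡1 x∈ y∈))
      strong (inj₂ (ℓ , refl)) ¬const x∈ y∈ x⊏y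
        with ∈-column⁻ r n ℓ x∈ | ∈-column⁻ r n ℓ y∈
      ... | i , refl | i′ , refl with ≺-combine⁻ r n {i = i} {i′} {ℓ} {ℓ} x⊏y
      ...   | inj₁ ℓ<ℓ        = ⊥-elim (Fin.<-irrefl refl ℓ<ℓ)
      ...   | inj₂ (_ , i<i′) = Listing.increasing (vertex-listing ℓ)
        (λ ≡1 → ¬const λ x∈ y∈ → ∣e∣≡1⇒≡ ≡1 (in-edge x∈) (in-edge y∈)) i<i′
        where
        in-edge : ∀ {x} → x ∈ column r (natural n) ℓ → vertex x ∈ edgeAt h ℓ
        in-edge x∈ = subst (_ ∈_) (image-column ℓ) (∈-image⁺ vertex (column r (natural n) ℓ) x∈)

-- The word of a quotient map

module _ {r} (A B : OrderedHypergraph r) where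
  private
    module A = OrderedHypergraph A
    module B = OrderedHypergraph B
    module EA = Enumeration (edgeEnumeration A)
    module EB = Enumeration (edgeEnumeration B)
  open StrongRigidQuotientMap

  abstract
    edgeWord : (f : StrongRigidQuotientMap B A) →
               ∃[ g ] (∀ i → edgeAt A g i ≡ image (map f) (EB.at i))
    edgeWord f = rigid-word (image (map f) ∘ EB.at) (at-distinct A) record
      { covered = λ i → let j , eq = EA.complete (hom f (EB.sound i)) in inj₂ (j , sym eq)
      ; onto    = λ j →
          let (e , e∈E) , im = IsSurjection.surjective R.isSurjection (EA.at j , EA.sound j)
              i , eq         = EB.complete e∈E
          in i , im {EB.at i , EB.sound i} eq
      -- The least preimage of `EA.at j′` precedes that of `EA.at j`, which is at most `EB.at i`.
      ; ordered = λ {i} {j} {j′} eq j′<j →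
          let (x′ , x′∈E) , _ , (im′ , _) , (_ , x≤) , x′<x =
                R.rigid {EA.at j′ , EA.sound j′} {EA.at j , EA.sound j} (EA.mono j′<j)
              i′ , eq′ = EB.complete x′∈E
          in i′
           , mono-reflects B.sal-isStrictTotalOrder EB.mono
               (subst (B._⊏sal EB.at i) (sym eq′) (below x′<x (x≤ (EB.at i , EB.sound i) eq)))
           , trans (cong (image (map f)) eq′) im′
      }
      where
      module R = IsRigidSurjection (rigid f)
      below : ∀ {x y z} → x B.⊏sal y → y B.⊏sal z ⊎ y ≡ z → x B.⊏sal z
      below x<y (inj₁ y<z)  = IsStrictTotalOrder.trans B.sal-isStrictTotalOrder x<y y<z
      below x<y (inj₂ refl) = x<y

  -- On each column both sides list the image under `f` of the edge `edgeAt B h ℓ`, and such a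
  -- listing is unique.
  quotientMap-⊙ : ∀ (r≥2 : 2 ≤ r) (f : StrongRigidQuotientMap B A) (h : PWord 0 EB.size n) u →
                  map f (vertex B r≥2 h u) ≡ vertex A r≥2 (h ⊙ proj₁ (edgeWord f)) u
  quotientMap-⊙ {n = n} r≥2 f h u with Fin.combine-surjective {r} u
  ... | i , ℓ , refl = listing-unique A
    (listing-map B A f (edgeAt∈E B h ℓ) (vertex-listing B r≥2 h ℓ))
    (subst (λ e → Listing A e λ i → vertex A r≥2 (h ⊙ g) (combine i ℓ)) edge-eq
           (vertex-listing A r≥2 (h ⊙ g) ℓ)) i
    where
    g = proj₁ (edgeWord f)
    edge-eq : edgeAt A (h ⊙ g) ℓ ≡ image (map f) (edgeAt B h ℓ)
    edge-eq = trans (eval-sub {ρ′ = none} (λ ()) h g ℓ)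
      (sym (eval-natural (image (map f)) (λ ()) (λ j → sym (proj₂ (edgeWord f) j)) h ℓ))

-- The dual Ramsey property

-- Colour the word h by quotientMap h · to.  The monochromatic word h of the
-- Graham–Rothschild theorem gives w = quotientMap h · to, since f · w is the
-- map of the word h ⊙ edgeWord f.
ramsey : 2 ≤ r → ∀ k → 2 ≤ k → (A B : OrderedHypergraph r) →
         let open Category (OHgr-srq r) in
         ∃[ n ] (∀ {G} → Hom G (r ⊠ natural n) → (χ : Func (homSetoid G A) (setoid (Fin k))) →
         ∃[ w ] (∀ (f g : Hom B A) → Func.to χ (f · w) ≡ Func.to χ (g · w)))
ramsey {r} r≥2 (suc k) _ A B =
  let n , mono = graham-rothschild 0 (Enumeration.size (edgeEnumeration A)) (suc k) zero
                                     (Enumeration.size (edgeEnumeration B))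
  in n , λ {G} to χ →
  let h , color , h-mono = mono λ h → Func.to χ (_·_ {G} {r ⊠ natural n} {A} (quotientMap A r≥2 h) to)
      w : Hom G B
      w = _·_ {G} {r ⊠ natural n} {B} (quotientMap B r≥2 h) to
      χ-color : (f : Hom B A) → Func.to χ (_·_ {G} {B} {A} f w) ≡ color
      χ-color f = trans
        (Func.cong χ (λ x → quotientMap-⊙ A B r≥2 f h (StrongRigidQuotientMap.map to x)))
        (h-mono (proj₁ (edgeWord A B f)))
  in w , λ f g → trans (χ-color f) (sym (χ-color g))
  where open Category (OHgr-srq r)

dualRamsey-full : 2 ≤ r → (P : Pred (OrderedHypergraph r) p) →
                  (∀ n → ∃[ G ] (P G × Category.Hom (OHgr-srq r) G (r ⊠ natural n))) →
                  DualRamsey (FullSubcategory (OHgr-srq r) P)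
dualRamsey-full r≥2 P cofinal k k≥2 (A , _) (B , _) _ =
  let n , R       = ramsey r≥2 k k≥2 A B
      G , PG , to = cofinal n
  in (G , PG) , R to

dualRamsey : 2 ≤ r → DualRamsey (OHgr-srq r)
dualRamsey r≥2 k k≥2 A B _ =
  let n , R = ramsey r≥2 k k≥2 A B in _ , R (idMap _)

-- Bipartite and clique-free graphs

⊠-bipartite : ∀ n → Bipartite (2 ⊠ natural n)
⊠-bipartite n = left , λ { (x≢y , inj₁ ≡1) → contradiction (∣e∣≡1⇒≡ ≡1 (∈ˡ _ _) (∈ʳ _ _)) x≢y
                      ; (x≢y , inj₂ (ℓ , eq)) → sides x≢y
                          (∈-column⁻ 2 n ℓ (subst (_ ∈_) eq (∈ˡ _ _)))
                          (∈-column⁻ 2 n ℓ (subst (_ ∈_) eq (∈ʳ _ _))) }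
  where
  node : Fin 2 → Fin n → Fin (2 * n)
  node = combine
  left : Subset (2 * n)
  left = image (node zero) Subset.⊤
  ∈ˡ : ∀ (x y : Fin (2 * n)) → x ∈ ⁅ x ⁆ ∪ ⁅ y ⁆
  ∈ˡ x y = x∈p∪q⁺ (inj₁ (x∈⁅x⁆ x))
  ∈ʳ : ∀ (x y : Fin (2 * n)) → y ∈ ⁅ x ⁆ ∪ ⁅ y ⁆
  ∈ʳ x y = x∈p∪q⁺ (inj₂ (x∈⁅x⁆ y))
  zero∈ : ∀ ℓ → node zero ℓ ∈ left
  zero∈ ℓ = ∈-image⁺ (node zero) Subset.⊤ (∈⊤ {x = ℓ})
  one∉ : ∀ ℓ → node (suc zero) ℓ ∉ left
  one∉ ℓ ∈left = let ℓ′ , _ , eq = ∈-image⁻ (node zero) Subset.⊤ ∈left in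
    contradiction (Fin.combine-injectiveˡ {2} zero ℓ′ (suc zero) ℓ eq) λ ()
  sides : ∀ {ℓ} {x y : Fin (2 * n)} → x ≢ y →
          ∃[ i ] node i ℓ ≡ x → ∃[ j ] node j ℓ ≡ y → (x ∈ left × y ∉ left) ⊎ (x ∉ left × y ∈ left)
  sides x≢y (zero , refl)     (zero , refl)     = contradiction refl x≢y
  sides x≢y (zero , refl)     (suc zero , refl) = inj₁ (zero∈ _ , one∉ _)
  sides x≢y (suc zero , refl) (zero , refl)     = inj₂ (one∉ _ , zero∈ _)
  sides x≢y (suc zero , refl) (suc zero , refl) = contradiction refl x≢y

-- Two of any three vertices lie on the same side, whereas in a clique they would be adjacent.
bipartite⇒KFree : ∀ {n} (G : OrderedHypergraph 2) → 3 ≤ n → Bipartite G → KFree G n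
bipartite⇒KFree {n} G n≥3 (X , bip) (K , ∣K∣≡n , clique) =
  let i , j , i<j , same = Fin.pigeonhole (subst (2 <_) (sym size≡n) n≥3) (side ∘ at)
  in same-side same (bip (clique (sound i) (sound j)
       (λ eq → Fin.<⇒≢ i<j (mono-injective isStrictTotalOrder mono eq))))
  where
  open OrderedHypergraph G
  enum = enumerateSubset isStrictTotalOrder K
  open Enumeration enum
  size≡n : size ≡ n
  size≡n = trans (size≡∣∣ isStrictTotalOrder enum) ∣K∣≡n
  side : Fin order → Fin 2
  side x with x ∈? X
  ... | yes _ = zero
  ... | no  _ = suc zero
  same-side : ∀ {x y} → side x ≡ side y → ¬ ((x ∈ X × y ∉ X) ⊎ (x ∉ X × y ∈ X))
  same-side {x} {y} eq xy with x ∈? X | y ∈? X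
  same-side eq (inj₁ (_ , y∉)) | yes _  | yes y∈ = y∉ y∈
  same-side eq (inj₂ (x∉ , _)) | yes x∈ | yes _  = x∉ x∈
  same-side eq (inj₁ (x∈ , _)) | no x∉  | no _   = x∉ x∈
  same-side eq (inj₂ (_ , y∈)) | no _   | no y∉  = y∉ y∈

corollary5p8 : (p : Level) →
    (∀ (r : ℕ) → 2 ≤ r →
    (P : Pred (OrderedHypergraph r) p) →
    (∀ (L : FiniteChain) → ∃[ G ] (P G × Category._≅_ (OHgr-srq r) G (r ⊠ L))) →
    DualRamsey (FullSubcategory (OHgr-srq r) P))
    × (∀ (r : ℕ) → 2 ≤ r → DualRamsey (OHgr-srq r))
    × DualRamsey OGra-srq
    × DualRamsey (FullSubcategory OGra-srq Bipartite)
    × (∀ (n : ℕ) → 3 ≤ n → DualRamsey (FullSubcategory OGra-srq (λ G → KFree G n)))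
corollary5p8 p =
    (λ r r≥2 P cofinal → dualRamsey-full r≥2 P λ n →
      let G , PG , iso = cofinal (natural n) in G , PG , Category._≅_.to iso)
  , (λ r → dualRamsey)
  , dualRamsey ℕ.≤-refl
  , dualRamsey-full ℕ.≤-refl Bipartite (λ n → _ , ⊠-bipartite n , idMap _)
  , λ m m≥3 → dualRamsey-full ℕ.≤-refl (λ G → KFree G m) λ n →
      _ , bipartite⇒KFree (2 ⊠ natural n) m≥3 (⊠-bipartite n) , idMap _
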